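{- Let $G$ be a VPT graph and let $h\geq 3$. If $G$ is a minimal non $[h,2,1]$ graph, then $G$ is a split graph without dominated stable vertices.
   Context: All graphs are finite, simple and connected. A VPT representation of $G$ is a tree $T$ together with paths $(P_v)_{v\in V(G)}$ of $T$ such that $uv\in E(G)$ iff $P_u$ and $P_v$ share a vertex; $G$ is VPT if it has one. $[h,2,1]$ is the class of graphs admitting a VPT representation whose host tree has maximum degree at most $h$. A minimal non $[h,2,1]$ graph is a graph $G\notin[h,2,1]$ with $G-v\in[h,2,1]$ for all $v\in V(G)$. A graph is split if $V(G)$ can be partitioned into a stable set $S$ and a clique $K$ (split partition $(S,K)$). A vertex $s$ is a dominated stable vertex if $s\in S$ and there exists $s'\in S$, $s'\neq s$, with $N(s)\subseteq N(s')$. -}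

module Defs where

open import Data.Nat using (ℕ; zero; suc; _≤_)
open import Data.Bool using (Bool; true; false)
open import Data.Fin using (Fin; punchIn)
open import Data.Fin.Subset using (∣_∣)
open import Data.Vec using (tabulate)
open import Data.List using (List; []; _∷_; last)
open import Data.Maybe using (just)
open import Data.List.Membership.Propositional using (_∈_)
open import Data.List.Relation.Unary.Unique.Propositional using (Unique)
open import Data.List.Relation.Unary.Linked using (Linked)
open import Data.Product using (Σ; ∃; _×_)
open import Relation.Nullary using (¬_)
open import Relation.Binary.PropositionalEquality using (_≡_; _≢_)
open import Function.Bundles using (_⇔_)

record Graph (n : ℕ) : Set where
  field
    adj    : Fin n → Fin n → Bool
    sym    : ∀ x y → adj x y ≡ adj y x
    irrefl : ∀ x → adj x x ≡ false
open Graph public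

Edge : ∀ {n} → Graph n → Fin n → Fin n → Set
Edge G x y = adj G x y ≡ true

IsPath : ∀ {n} → Graph n → List (Fin n) → Set
IsPath G []       = Data.Empty.⊥
  where import Data.Empty
IsPath G (x ∷ xs) = Unique (x ∷ xs) × Linked (Edge G) (x ∷ xs)

PathFromTo : ∀ {n} → Graph n → Fin n → Fin n → List (Fin n) → Set
PathFromTo G x y []       = Data.Empty.⊥
  where import Data.Empty
PathFromTo G x y (z ∷ zs) = IsPath G (z ∷ zs) × z ≡ x × last (z ∷ zs) ≡ just y

Connected : ∀ {n} → Graph n → Set
Connected {n} G = ∀ (x y : Fin n) → ∃ λ (p : List (Fin n)) → PathFromTo G x y p

IsCycle : ∀ {n} → Graph n → List (Fin n) → Set
IsCycle G (x ∷ y ∷ z ∷ zs) =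
  Unique (x ∷ y ∷ z ∷ zs) × Linked (Edge G) (x ∷ y ∷ z ∷ zs)
    × Σ (Fin _) (λ w → last (z ∷ zs) ≡ just w × Edge G w x)
IsCycle G _ = Data.Empty.⊥
  where import Data.Empty

IsTree : ∀ {m} → Graph m → Set
IsTree {m} T = (1 ≤ m) × Connected T × (∀ (c : List (Fin m)) → ¬ IsCycle T c)

degree : ∀ {m} → Graph m → Fin m → ℕ
degree T x = ∣ tabulate (adj T x) ∣

MaxDegree≤ : ∀ {m} → Graph m → ℕ → Set
MaxDegree≤ T h = ∀ x → degree T x ≤ h

Share : ∀ {m} → List (Fin m) → List (Fin m) → Set
Share {m} p q = ∃ λ (x : Fin m) → x ∈ p × x ∈ q

record VPTRep {n} (G : Graph n) : Set where
  field
    m     : ℕ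
    T     : Graph m
    tree  : IsTree T
    P     : Fin n → List (Fin m)
    paths : ∀ v → IsPath T (P v)
    rep   : ∀ u v → u ≢ v → (Edge G u v ⇔ Share (P u) (P v))
open VPTRep public

IsVPT : ∀ {n} → Graph n → Set
IsVPT G = VPTRep G

InH21 : ℕ → ∀ {n} → Graph n → Set
InH21 h G = Σ (VPTRep G) λ R → MaxDegree≤ (T R) h

delete : ∀ {n} → Graph (suc n) → Fin (suc n) → Graph n
delete G v = record
  { adj    = λ i j → adj G (punchIn v i) (punchIn v j)
  ; sym    = λ i j → sym G (punchIn v i) (punchIn v j)
  ; irrefl = λ i → irrefl G (punchIn v i)
  }

MinimalNonH21 : ℕ → ∀ {n} → Graph (suc n) → Set
MinimalNonH21 h G = ¬ InH21 h G × (∀ v → InH21 h (delete G v))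

-- split partition (S,K): S v = true means v ∈ S, otherwise v ∈ K.
IsSplitPartition : ∀ {n} → Graph n → (Fin n → Bool) → Set
IsSplitPartition G S =
    (∀ u v → S u ≡ true → S v ≡ true → ¬ Edge G u v)
  × (∀ u v → S u ≡ false → S v ≡ false → u ≢ v → Edge G u v)

DominatedStable : ∀ {n} → Graph n → (Fin n → Bool) → Fin n → Set
DominatedStable {n} G S s =
  S s ≡ true × ∃ λ (s' : Fin n) → S s' ≡ true × s' ≢ s
    × (∀ x → Edge G s x → Edge G s' x)

SplitWithoutDominatedStable : ∀ {n} → Graph n → Set
SplitWithoutDominatedStable {n} G =
  ∃ λ (S : Fin n → Bool) → IsSplitPartition G S × (∀ s → ¬ DominatedStable G S s)

module Submission where

-- Fix a representation in which no host edge can be contracted. For a host vertex q let C be the clique of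
-- paths through q, and order the vertices outside C by inclusion of their neighbourhoods in C (their traces).
-- Two adjacent vertices outside C have comparable traces, so if no trace contains another one, then
-- (V ∖ C , C) is a split partition without dominated stable vertices.
--
-- Otherwise every q has w ≠ v outside C with the trace of w inside that of v. A representation of G - w on a
-- tree of maximum degree at most h colours the branch graph of C without w (adjacency: traces intersect and
-- are incomparable) with the h branches at a common vertex of the paths in C; recolouring the vertices below v
-- extends this colouring to w. It induces a colouring of the branches at q in which branches of equal colour
-- are not joined by a path through q, hence can be moved together to a new neighbour of q. Repeating this
-- brings all degrees down to h, contradicting G ∉ [h,2,1].

open import Defs
open import Data.Bool using (Bool; true; false; not)
open import Data.Bool.Properties using () renaming (_≟_ to _≟ᵇ_)
open import Data.Empty using (⊥; ⊥-elim)
open import Data.Fin using (Fin; zero; suc; punchIn; punchOut; inject≤)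
open import Data.Fin.Properties using (_≟_; any?; all?; <-cmp; injective⇒≤; inject≤-injective; punchIn-injective; punchIn-punchOut; suc-injective)
open import Data.Fin.Subset using (∣_∣)
open import Data.List using (List; []; _∷_; last; length; filter; allFin; map; cartesianProduct)
open import Data.List.Membership.Propositional using (_∈_; _∉_)
open import Data.List.Membership.Propositional.Properties using (∈-map⁺; ∈-filter⁺; ∈-filter⁻; ∈-allFin; ∈-cartesianProduct⁺)
open import Data.List.Properties using (length-map; filter-notAll)
open import Data.List.Relation.Unary.All as All using (All; []; _∷_)
open import Data.List.Relation.Unary.All.Properties using (¬Any⇒All¬)
open import Data.List.Relation.Unary.AllPairs using ([]; _∷_)
open import Data.List.Relation.Unary.Any as Any using (Any; here; there)
open import Data.List.Relation.Unary.Linked using ([]; [-]; _∷_)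
open import Data.Maybe using (just)
open import Data.Nat using (ℕ; zero; suc; _≤_; _<_; z≤n; s≤s)
open import Data.Nat.Properties using (≤-refl; <-≤-trans)
open import Data.Product using (∃; _×_; _,_; proj₁; proj₂)
open import Data.Product.Properties using (≡-dec)
open import Data.Sum using (_⊎_; inj₁; inj₂)
open import Data.Unit using (⊤; tt)
open import Data.Vec using (tabulate)
open import Function using (_∘_; id)
open import Function.Bundles using (mk⇔; Equivalence)
open import Relation.Binary.Definitions using (tri<; tri≈; tri>)
open import Relation.Binary.PropositionalEquality as ≡ using (_≡_; _≢_; refl; cong; subst)
open import Relation.Nullary using (¬_; Dec; yes; no; does; contradiction)
open import Relation.Nullary.Decidable using (¬?; _×-dec_; _⊎-dec_; _→-dec_; decidable-stable)
import Data.List.Membership.DecPropositional as DecMembership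

-- Walks and paths in trees

-- Traces compare vertices of `G`, whereas a split needs branches of the host tree. Reducedness
-- links the two: a neighbour `t` of `q` that is used at all lies on the route of some `v` outside
-- `C`, and the trace of `v` consists exactly of the vertices whose routes contain both `q` and `t`.
-- The obstacle is that the branch graph separates only branches with incomparable traces, while a
-- split must separate any two branches joined by a route through `q`. Comparable ones are repaired
-- by hand: a route uses at most two branches at `q`, so a branch whose trace lies inside that of
-- another one meets no third branch and can be recoloured after its only neighbour. The bound
-- `3 ≤ h` is spent on the split. The new host vertex has three neighbours, `q` and the first
-- vertices of the two moved branches; giving them three different colours ensures that the new
-- vertex never has to be split itself. Colourings are chosen at all host vertices at once, in the
-- reduced representation, and the splits carry properness along.

infix 4 _∈?_
_∈?_ : ∀ {k} (x : Fin k) (xs : List (Fin k)) → Dec (x ∈ xs)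
_∈?_ = DecMembership._∈?_ _≟_

edge? : ∀ {k} (T : Graph k) x y → Dec (Edge T x y)
edge? T x y = adj T x y ≟ᵇ true

edge-sym : ∀ {k} (T : Graph k) {x y} → Edge T x y → Edge T y x
edge-sym T {x} {y} e = ≡.trans (sym T y x) e

edge-≢ : ∀ {k} (T : Graph k) {x y} → Edge T x y → x ≢ y
edge-≢ T {x} e refl = contradiction (≡.trans (≡.sym e) (irrefl T x)) λ ()

data Walk {k} (T : Graph k) (Q : Fin k → Set) : Fin k → Fin k → Set where
  stop : ∀ {x} → Q x → Walk T Q x x
  step : ∀ {x y z} → Q x → Edge T x y → Walk T Q y z → Walk T Q x z

-- Betweenness is expressed by separation: in a tree, `z` lies on the path from `x` to `y` iff no
-- walk between them avoids `z`. Paths of a modified tree are thus compared with old ones by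
-- transporting walks.
Avoiding : ∀ {k} → Graph k → Fin k → Fin k → Fin k → Set
Avoiding T z = Walk T (_≢ z)

Acyclic : ∀ {k} → Graph k → Set
Acyclic T = ∀ {z x y} → Edge T z x → Edge T z y → x ≢ y → ¬ Avoiding T z x y

module _ {k} {T : Graph k} where

  walk-start : ∀ {Q x y} → Walk T Q x y → Q x
  walk-start (stop q) = q
  walk-start (step q _ _) = q

  walk-end : ∀ {Q x y} → Walk T Q x y → Q y
  walk-end (stop q) = q
  walk-end (step _ _ w) = walk-end w

  _++ʷ_ : ∀ {Q x y z} → Walk T Q x y → Walk T Q y z → Walk T Q x z
  stop _ ++ʷ w = w
  step q e v ++ʷ w = step q e (v ++ʷ w)

  reverseʷ : ∀ {Q x y} → Walk T Q x y → Walk T Q y x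
  reverseʷ (stop q) = stop q
  reverseʷ (step q e w) = reverseʷ w ++ʷ step (walk-start w) (edge-sym T e) (stop q)

  mapʷ : ∀ {Q Q′ : Fin k → Set} {x y} → (∀ {z} → Q z → Q′ z) → Walk T Q x y → Walk T Q′ x y
  mapʷ f (stop q) = stop (f q)
  mapʷ f (step q e w) = step (f q) e (mapʷ f w)

  simulate : ∀ {T′ : Graph k} {Q Q′ : Fin k → Set} {x y} → (∀ {z} → Q z → Q′ z)
    → (∀ {u v} → Q u → Q v → Edge T u v → Walk T′ Q′ u v)
    → Walk T Q x y → Walk T′ Q′ x y
  simulate f g (stop q) = stop (f q)
  simulate {T′} f g (step q e w) = append (g q (walk-start w) e) (simulate f g w)
    where
    append : ∀ {Q x y z} → Walk T′ Q x y → Walk T′ Q y z → Walk T′ Q x z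
    append (stop _) w = w
    append (step q e v) w = step q e (append v w)

  firstHit : ∀ {Q x a} → Walk T Q x a → x ≢ a
    → ∃ λ b → Edge T b a × Walk T (λ u → Q u × u ≢ a) x b
  firstHit (stop _) x≢a = contradiction refl x≢a
  firstHit {a = a} (step {y = y} q e w) x≢a with y ≟ a
  ... | yes refl = _ , e , stop (q , x≢a)
  ... | no y≢a with b , f , v ← firstHit w y≢a = b , f , step (q , x≢a) e v

  last-∈ : ∀ {y : Fin k} z zs → last (z ∷ zs) ≡ just y → y ∈ z ∷ zs
  last-∈ z [] refl = here refl
  last-∈ z (z′ ∷ zs) eq = there (last-∈ z′ zs eq)

  path-edge : ∀ {x y z z′ zs} → PathFromTo T x y (z ∷ z′ ∷ zs) → Edge T z z′
  path-edge ((_ , e ∷ _) , _) = e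

  path-tail : ∀ {x y z z′ zs} → PathFromTo T x y (z ∷ z′ ∷ zs) → PathFromTo T z′ y (z′ ∷ zs)
  path-tail (((_ ∷ u) , _ ∷ l) , _ , eq) = (u , l) , refl , eq

  from-walk : ∀ {x y p u} → PathFromTo T x y p → u ∈ p → Walk T (_∈ p) u y
  from-walk {p = _ ∷ []} (_ , refl , refl) (here refl) = stop (here refl)
  from-walk {p = _ ∷ _ ∷ _} pf (here refl) =
    step (here refl) (path-edge pf) (mapʷ there (from-walk (path-tail pf) (here refl)))
  from-walk {p = _ ∷ _ ∷ _} pf (there u∈) = mapʷ there (from-walk (path-tail pf) u∈)

  start-∈ : ∀ {x y p} → PathFromTo T x y p → x ∈ p
  start-∈ {p = _ ∷ _} (_ , refl , _) = here refl

  end-∈ : ∀ {x y p} → PathFromTo T x y p → y ∈ p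
  end-∈ {p = z ∷ zs} (_ , _ , eq) = last-∈ z zs eq

  within : ∀ {x y p u v} → PathFromTo T x y p → u ∈ p → v ∈ p → Walk T (_∈ p) u v
  within pf u∈ v∈ = from-walk pf u∈ ++ʷ reverseʷ (from-walk pf v∈)

  avoid : ∀ {x y p u v z} → PathFromTo T x y p → z ∉ p → u ∈ p → v ∈ p → Avoiding T z u v
  avoid pf z∉ u∈ v∈ = mapʷ (λ w∈ eq → z∉ (subst (_∈ _) eq w∈)) (within pf u∈ v∈)

  suffix : ∀ {Q : Fin k → Set} {x y p u} → PathFromTo T x y p → All Q p → u ∈ p
    → ∃ λ p′ → PathFromTo T u y p′ × All Q p′
  suffix {p = _ ∷ _} pf@(_ , refl , _) qs (here refl) = _ , pf , qs
  suffix {p = _ ∷ _ ∷ _} pf (_ ∷ qs) (there u∈) = suffix (path-tail pf) qs u∈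

  loop-erase : ∀ {Q x y} → Walk T Q x y → ∃ λ p → PathFromTo T x y p × All Q p
  loop-erase {x = x} (stop q) = x ∷ [] , (([] ∷ [] , [-]) , refl , refl) , q ∷ []
  loop-erase {x = x} (step q e w) with loop-erase w
  ... | p@(_ ∷ _) , pf@((u , l) , refl , eq) , qs with x ∈? p
  ... | yes x∈ = suffix pf qs x∈
  ... | no x∉ = x ∷ p , ((¬Any⇒All¬ p x∉ ∷ u , e ∷ l) , refl , eq) , q ∷ qs

mkTree : ∀ {k} {T : Graph k} → 1 ≤ k → (∀ x y → Walk T (λ _ → ⊤) x y) → Acyclic T → IsTree T
mkTree {T = T} 1≤k conn acyc = 1≤k , connected , no-cycle
  where
  connected : Connected T
  connected x y with p , pf , _ ← loop-erase (conn x y) = p , pf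
  no-cycle : ∀ c → ¬ IsCycle T c
  no-cycle (x ∷ y ∷ z ∷ zs) ((x∉ ∷ y∉ ∷ u) , exy ∷ l , w , eq , ewx) =
    acyc exy (edge-sym T ewx) (All.lookup y∉ w∈) (mapʷ (λ v∈ v≡x → All.lookup x∉ v∈ (≡.sym v≡x))
      (from-walk {x = y} ((y∉ ∷ u , l) , refl , eq) (here refl)))
    where
    w∈ : w ∈ z ∷ zs
    w∈ = last-∈ {T = T} z zs eq

-- Separation, gates and the Helly property in a tree

module Tree {k} {T : Graph k} (isTree : IsTree T) where

  path : Fin k → Fin k → List (Fin k)
  path x y = proj₁ (proj₁ (proj₂ isTree) x y)

  path-ok : ∀ x y → PathFromTo T x y (path x y)
  path-ok x y = proj₂ (proj₁ (proj₂ isTree) x y)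

  acyclic : Acyclic T
  acyclic {z} e f x≢y w with loop-erase w
  ... | _ ∷ [] , (_ , refl , refl) , _ = x≢y refl
  ... | x ∷ x′ ∷ xs , ((u , l) , refl , eq) , qs =
    proj₂ (proj₂ isTree) (z ∷ x ∷ x′ ∷ xs)
      ((All.map (λ q eq′ → q (≡.sym eq′)) qs ∷ u) , e ∷ l , _ , eq , edge-sym T f)

  connect : ∀ x y → Walk T (λ _ → ⊤) x y
  connect x y = mapʷ _ (from-walk (path-ok x y) (start-∈ (path-ok x y)))

  -- Moving along the path, the walk is extended backwards until `z` is the next vertex. Then the
  -- predecessor and the successor of `z` on the path are joined by a walk avoiding `z`, against
  -- acyclicity.
  separates : ∀ {x y p z} → PathFromTo T x y p → z ∈ p → ¬ Avoiding T z x y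
  separates {p = _ ∷ _} (_ , refl , _) (here refl) w = walk-start w refl
  separates {p = _ ∷ x₂ ∷ _} {z} pf@(_ , refl , _) (there z∈) w with x₂ ≟ z
  ... | no x₂≢z = separates (path-tail {T = T} pf) z∈ (step x₂≢z (edge-sym T (path-edge {T = T} pf)) w)
  separates {p = _ ∷ _ ∷ []} (_ , refl , refl) (there _) w | yes refl = walk-end w refl
  separates {p = _ ∷ _ ∷ _ ∷ _} pf@(((x∉ ∷ x₂∉ ∷ _) , _) , refl , _) (there _) w | yes refl =
    acyclic (edge-sym T (path-edge {T = T} pf)) (path-edge {T = T} (path-tail {T = T} pf)) (All.lookup x∉ (there (here refl)))
      (w ++ʷ reverseʷ (mapʷ (λ v∈ eq → All.lookup x₂∉ v∈ (≡.sym eq))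
        (from-walk (path-tail {T = T} (path-tail {T = T} pf)) (here refl))))

  not-avoiding⇒∈ : ∀ {x y p z} → PathFromTo T x y p → ¬ Avoiding T z x y → z ∈ p
  not-avoiding⇒∈ {p = p} {z} pf ¬w with z ∈? p
  ... | yes z∈ = z∈
  ... | no z∉ = contradiction (avoid pf z∉ (start-∈ pf) (end-∈ pf)) ¬w

  side : ∀ {x y p u} → PathFromTo T x y p → ∀ z → u ∈ p → u ≢ z → Avoiding T z x u ⊎ Avoiding T z u y
  side {p = _ ∷ _} (_ , refl , _) z (here refl) u≢z = inj₁ (stop u≢z)
  side {p = x ∷ _ ∷ _} pf@(((x∉ ∷ _) , _) , refl , _) z (there u∈) u≢z with x ≟ z
  ... | yes refl = inj₂ (mapʷ (λ v∈ eq → All.lookup x∉ v∈ (≡.sym eq)) (from-walk (path-tail {T = T} pf) u∈))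
  ... | no x≢z with side (path-tail {T = T} pf) z u∈ u≢z
  ... | inj₁ w = inj₁ (step x≢z (path-edge {T = T} pf) w)
  ... | inj₂ w = inj₂ w

  two-sides : ∀ {x y p u v w} → PathFromTo T x y p → ∀ z → u ∈ p → v ∈ p → w ∈ p
    → u ≢ z → v ≢ z → w ≢ z → Avoiding T z u v ⊎ Avoiding T z v w ⊎ Avoiding T z u w
  two-sides pf z u∈ v∈ w∈ u≢ v≢ w≢ with side pf z u∈ u≢ | side pf z v∈ v≢ | side pf z w∈ w≢
  ... | inj₁ a | inj₁ b | _ = inj₁ (reverseʷ a ++ʷ b)
  ... | inj₂ a | inj₂ b | _ = inj₁ (a ++ʷ reverseʷ b)
  ... | _ | inj₁ b | inj₁ c = inj₂ (inj₁ (reverseʷ b ++ʷ c))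
  ... | _ | inj₂ b | inj₂ c = inj₂ (inj₁ (b ++ʷ reverseʷ c))
  ... | inj₁ a | inj₂ _ | inj₁ c = inj₂ (inj₂ (reverseʷ a ++ʷ c))
  ... | inj₂ a | inj₁ _ | inj₂ c = inj₂ (inj₂ (a ++ʷ reverseʷ c))

  race : ∀ {u v} y → u ≢ v → Avoiding T v y u ⊎ Avoiding T u y v
  race {u} {v} y u≢v = go (connect y u)
    where
    go : ∀ {y} → Walk T (λ _ → ⊤) y u → Avoiding T v y u ⊎ Avoiding T u y v
    go (stop _) = inj₁ (stop u≢v)
    go (step {x = x} _ e w) with x ≟ u | x ≟ v | go w
    ... | yes refl | _ | _ = inj₁ (stop u≢v)
    ... | _ | yes refl | _ = inj₂ (stop (u≢v ∘ ≡.sym))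
    ... | no _ | no x≢v | inj₁ a = inj₁ (step x≢v e a)
    ... | no x≢u | no _ | inj₂ a = inj₂ (step x≢u e a)

  -- The far end `y` reaches one of `u`, `v` before the other; combined with the matching walk from
  -- `x`, this bypasses a vertex of the path.
  ordered : ∀ {x y p u v} → PathFromTo T x y p → u ∈ p → v ∈ p
    → Avoiding T v x u → ¬ Avoiding T u x v
  ordered {y = y} pf u∈ v∈ a b with race y (walk-end a)
  ... | inj₁ c = separates pf v∈ (a ++ʷ reverseʷ c)
  ... | inj₂ c = separates pf u∈ (b ++ʷ reverseʷ c)

  reverse-∈ : ∀ {x y p q z} → PathFromTo T x y p → PathFromTo T y x q → z ∈ p → z ∈ q
  reverse-∈ pf pf′ z∈ = not-avoiding⇒∈ pf′ λ w → separates pf z∈ (reverseʷ w)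

  ordered′ : ∀ {x y p u v} → PathFromTo T x y p → u ∈ p → v ∈ p
    → Avoiding T v u y → ¬ Avoiding T u v y
  ordered′ {x} {y} pf u∈ v∈ a b =
    ordered pf′ (reverse-∈ pf pf′ u∈) (reverse-∈ pf pf′ v∈) (reverseʷ a) (reverseʷ b)
    where pf′ = path-ok y x

  -- The middle one of three vertices separates the others. The cuts are taken cyclically (`u`
  -- against `w`, `v` against `u`, `w` against `v`), so that every outcome places two vertices each
  -- before the other as seen from one end.
  one-between : ∀ {x y p u v w} → PathFromTo T x y p → u ∈ p → v ∈ p → w ∈ p
    → Avoiding T w u v → Avoiding T u v w → ¬ Avoiding T v u w
  one-between pf u∈ v∈ w∈ uv vw uw
    with side pf _ u∈ (walk-start uv) | side pf _ v∈ (walk-start vw) | side pf _ w∈ (walk-end uw)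
  ... | inj₁ a | inj₁ b | _ = ordered pf u∈ w∈ a (b ++ʷ vw)
  ... | inj₁ a | inj₂ _ | inj₁ c = ordered pf v∈ w∈ (a ++ʷ uv) c
  ... | inj₁ _ | inj₂ b | inj₂ c = ordered′ pf u∈ v∈ (uw ++ʷ c) b
  ... | inj₂ _ | inj₁ b | inj₁ c = ordered pf u∈ v∈ (c ++ʷ reverseʷ uw) b
  ... | inj₂ a | inj₁ _ | inj₂ c = ordered′ pf v∈ w∈ (reverseʷ uv ++ʷ a) c
  ... | inj₂ a | inj₂ b | _ = ordered′ pf u∈ w∈ a (reverseʷ vw ++ʷ b)

  between-neighbours : ∀ {x y p r b a} → PathFromTo T x y p → Edge T b r → Edge T b a → r ≢ a
    → r ∈ p → a ∈ p → b ∈ p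
  between-neighbours {p = p} {b = b} pf br ba r≢a r∈ a∈ with b ∈? p
  ... | yes b∈ = b∈
  ... | no b∉ = contradiction (avoid pf b∉ r∈ a∈) (acyclic br ba r≢a)

  -- The path enters `a` from some neighbour `c` on the side of `x`. Since `b` is a neighbour of `a`
  -- on the same side, acyclicity forces `b` to be `c`.
  neighbour-∈ : ∀ {x y p a b} → PathFromTo T x y p → a ∈ p → Edge T a b → Avoiding T a x b → b ∈ p
  neighbour-∈ {x} {p = p} {a} {b} pf a∈ ab w with b ∈? p
  ... | yes b∈ = b∈
  ... | no b∉ with firstHit (avoid pf b∉ (start-∈ pf) a∈) (walk-start w)
  ... | c , ca , v = contradiction (reverseʷ (mapʷ proj₂ v) ++ʷ w)
    (acyclic (edge-sym T ca) ab (proj₁ (walk-end v)))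

  -- The gate of p from r is the vertex of p closest to r.
  IsGate : Fin k → List (Fin k) → Fin k → Set
  IsGate r p g = g ∈ p × (∀ {w} → w ∈ p → ¬ Avoiding T g r w)

  gate : ∀ {x y p} → PathFromTo T x y p → ∀ r → ∃ (IsGate r p)
  gate {x} {y} {p} pf r = go (connect r x)
    where
    go : ∀ {r} → Walk T (λ _ → ⊤) r x → ∃ (IsGate r p)
    go (stop _) = x , start-∈ pf , λ _ w → walk-start w refl
    go {r} (step {y = r₁} _ e v) with r ∈? p | go v
    ... | yes r∈ | _ = r , r∈ , λ _ w → walk-start w refl
    ... | no r∉ | g , g∈ , sep = g , g∈ , bad
      where
      bad : ∀ {w} → w ∈ p → ¬ Avoiding T g r w
      bad w∈ a with r₁ ≟ g
      ... | no r₁≢g = sep w∈ (step r₁≢g (edge-sym T e) a)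
      ... | yes refl with firstHit (within pf w∈ g∈) (walk-end a)
      ... | c , cg , b = acyclic (edge-sym T e) (edge-sym T cg) (λ { refl → r∉ (proj₁ (walk-end b)) })
        (a ++ʷ mapʷ proj₂ b)

  through-gate : ∀ {x y p s r g} → PathFromTo T x y p → r ∈ p → IsGate r s g → Share p s → g ∈ p
  through-gate {p = p} {g = g} pf r∈ (_ , sep) (z , z∈p , z∈s) with g ∈? p
  ... | yes g∈ = g∈
  ... | no g∉ = contradiction (avoid pf g∉ r∈ z∈p) (sep z∈s)

  -- If neither gate lies on the other path, the gate reached first from `r` leads along its own
  -- path to the common vertex, entering the other path without its gate.
  gates-comparable : ∀ {x y p x′ y′ p′ r g g′} → PathFromTo T x y p → PathFromTo T x′ y′ p′
    → IsGate r p g → IsGate r p′ g′ → Share p p′ → g ∈ p′ ⊎ g′ ∈ p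
  gates-comparable {p = p} {p′ = p′} {r} {g} {g′} pf pf′ (g∈ , sep) (g′∈ , sep′) (z , z∈ , z∈′)
    with g ∈? p′ | g′ ∈? p
  ... | yes a | _ = inj₁ a
  ... | _ | yes b = inj₂ b
  ... | no a | no b with race r (λ { refl → a g′∈ })
  ... | inj₁ w = contradiction (w ++ʷ avoid pf b g∈ z∈) (sep′ z∈′)
  ... | inj₂ w = contradiction (w ++ʷ avoid pf′ a g′∈ z∈′) (sep z∈)

  -- If p and p′ lie in one branch at r, the traces on {paths through r} of "meets p" and "meets p′"
  -- are nested as soon as they intersect: their gates lie on a common path starting at r.
  same-branch-nested : ∀ {x y p x′ y′ p′ r u u′} → PathFromTo T x y p → PathFromTo T x′ y′ p′
    → r ∉ p → r ∉ p′ → u ∈ p → u′ ∈ p′ → Avoiding T r u u′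
    → ∀ {x₁ y₁ s₁ x₂ y₂ s₂ x₃ y₃ s₃}
    → PathFromTo T x₁ y₁ s₁ → r ∈ s₁ → Share s₁ p → Share s₁ p′
    → PathFromTo T x₂ y₂ s₂ → r ∈ s₂ → Share s₂ p → ¬ Share s₂ p′
    → PathFromTo T x₃ y₃ s₃ → r ∈ s₃ → Share s₃ p′ → ¬ Share s₃ p → ⊥
  same-branch-nested {r = r} pf pf′ r∉ r∉′ u∈ u′∈ br f₁ r₁ m₁ m₁′ f₂ r₂ m₂ n₂ f₃ r₃ m₃ n₃
    with gate pf r | gate pf′ r
  ... | g , G@(g∈ , _) | g′ , G′@(g′∈ , _) =
    one-between f₁ (through-gate f₁ r₁ G m₁) r₁ (through-gate f₁ r₁ G′ m₁′)
      (avoid f₂ (λ g′∈s → n₂ (g′ , g′∈s , g′∈)) (through-gate f₂ r₂ G m₂) r₂)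
      (avoid f₃ (λ g∈s → n₃ (g , g∈s , g∈)) r₃ (through-gate f₃ r₃ G′ m₃))
      (avoid pf r∉ g∈ u∈ ++ʷ (br ++ʷ avoid pf′ r∉′ u′∈ g′∈))

  helly : ∀ {I : Set} (P : I → List (Fin k)) → (∀ i → ∃ λ x → ∃ λ y → PathFromTo T x y (P i))
    → Fin k → (is : List I) → (∀ {i j} → i ∈ is → j ∈ is → Share (P i) (P j))
    → ∃ λ g → ∀ {i} → i ∈ is → g ∈ P i
  helly P pf r [] _ = r , λ ()
  helly {I} P pf r (i₀ ∷ is) meet with go i₀ is meet
    where
    -- The common vertex found is the gate, from r, of one of the paths.
    go : ∀ i₀ is → (∀ {i j} → i ∈ i₀ ∷ is → j ∈ i₀ ∷ is → Share (P i) (P j))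
      → ∃ λ i → i ∈ i₀ ∷ is × ∃ λ g → IsGate r (P i) g × (∀ {j} → j ∈ i₀ ∷ is → g ∈ P j)
    go i₀ [] _ with gate (proj₂ (proj₂ (pf i₀))) r
    ... | g , G = i₀ , here refl , g , G , λ { (here refl) → proj₁ G }
    go i₀ (i₁ ∷ is) meet with go i₁ is (λ a b → meet (there a) (there b)) | gate (proj₂ (proj₂ (pf i₀))) r
    ... | v , v∈ , g , G@(g∈ , sep) , all | g′ , G′@(g′∈ , sep′) with g ∈? P i₀
    ... | yes g∈₀ = v , there v∈ , g , G , λ { (here refl) → g∈₀ ; (there j∈) → all j∈ }
    -- As `g` misses `P i₀`, the new gate `g′` lies on `P v`, hence beyond `g` as seen from `r`. A
    -- path that contains `g` and meets `P i₀` must then pass through `g′`.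
    ... | no g∉₀ = i₀ , here refl , g′ , G′ , λ { (here refl) → g′∈ ; (there j∈) → on j∈ }
      where
      pf₀ = proj₂ (proj₂ (pf i₀))
      pfᵥ = proj₂ (proj₂ (pf v))
      g′∈v : g′ ∈ P v
      g′∈v with gates-comparable pf₀ pfᵥ G′ G (meet (here refl) (there v∈))
      ... | inj₁ a = a
      ... | inj₂ b = contradiction b g∉₀
      on : ∀ {j} → j ∈ i₁ ∷ is → g′ ∈ P j
      on {j} j∈ with g′ ∈? P j | meet (here refl) (there j∈)
      ... | yes a | _ = a
      ... | no a | t , t∈₀ , t∈j with race r (λ { refl → g∉₀ g′∈ })
      ... | inj₁ w = contradiction (w ++ʷ avoid (proj₂ (proj₂ (pf j))) a (all j∈) t∈j) (sep′ t∈₀)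
      ... | inj₂ w = contradiction w (sep g′∈v)
  ... | _ , _ , g , _ , all = g , all

-- Surgery on host trees

Joins : ∀ {k} → Fin k → Fin k → Fin k → Fin k → Set
Joins x y u v = (u ≡ x × v ≡ y) ⊎ (u ≡ y × v ≡ x)

joins? : ∀ {k} (x y u v : Fin k) → Dec (Joins x y u v)
joins? x y u v = ((u ≟ x) ×-dec (v ≟ y)) ⊎-dec ((u ≟ y) ×-dec (v ≟ x))

joins-sym : ∀ {k} {x y u v : Fin k} → Joins x y u v → Joins x y v u
joins-sym (inj₁ (p , q)) = inj₂ (q , p)
joins-sym (inj₂ (p , q)) = inj₁ (q , p)

module FromRelation {k} (R : Fin k → Fin k → Set) (R? : ∀ x y → Dec (R x y))
  (R-sym : ∀ {x y} → R x y → R y x) (R-irrefl : ∀ {x} → ¬ R x x) where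

  private
    does-sym : ∀ x y → does (R? x y) ≡ does (R? y x)
    does-sym x y with R? x y | R? y x
    ... | yes _ | yes _ = refl
    ... | no _ | no _ = refl
    ... | yes r | no ¬r = contradiction (R-sym r) ¬r
    ... | no ¬r | yes r = contradiction (R-sym r) ¬r

    does-irrefl : ∀ x → does (R? x x) ≡ false
    does-irrefl x with R? x x
    ... | yes r = contradiction r R-irrefl
    ... | no _ = refl

  abstract
    graph : Graph k
    graph = record { adj = λ x y → does (R? x y) ; sym = does-sym ; irrefl = does-irrefl }

    edge⁺ : ∀ {x y} → R x y → Edge graph x y
    edge⁺ {x} {y} r with R? x y
    ... | yes _ = refl
    ... | no ¬r = contradiction r ¬r

    edge⁻ : ∀ {x y} → Edge graph x y → R x y
    edge⁻ {x} {y} e with R? x y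
    ... | yes r = r
    ... | no _ = contradiction e λ ()

-- Contracting a host edge and splitting a host vertex are both composed of slides. The routes keep
-- their ends, so a slide only affects which routes contain a and b.
module Slide {k} {T : Graph k} (isTree : IsTree T) (a b s : Fin k)
  (ab : Edge T a b) (as : Edge T a s) (b≢s : b ≢ s) where

  open Tree isTree

  a≢b : a ≢ b
  a≢b = edge-≢ T ab

  a≢s : a ≢ s
  a≢s = edge-≢ T as

  Slid : Fin k → Fin k → Set
  Slid x y = (Edge T x y × ¬ Joins a s x y) ⊎ Joins b s x y

  private
    slid-sym : ∀ {x y} → Slid x y → Slid y x
    slid-sym (inj₁ (e , ¬j)) = inj₁ (edge-sym T e , ¬j ∘ joins-sym)
    slid-sym (inj₂ j) = inj₂ (joins-sym j)

    slid-irrefl : ∀ {x} → ¬ Slid x x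
    slid-irrefl (inj₁ (e , _)) = edge-≢ T e refl
    slid-irrefl (inj₂ (inj₁ (refl , eq))) = b≢s eq
    slid-irrefl (inj₂ (inj₂ (refl , eq))) = b≢s (≡.sym eq)

  open FromRelation Slid (λ x y → (edge? T x y ×-dec ¬? (joins? a s x y)) ⊎-dec joins? b s x y)
    slid-sym slid-irrefl public renaming (graph to slid; edge⁺ to slid⁺; edge⁻ to slid⁻)

  bs′ : Edge slid b s
  bs′ = slid⁺ (inj₂ (inj₁ (refl , refl)))

  keep : ∀ {u v} → Edge T u v → ¬ Joins a s u v → Edge slid u v
  keep e ¬j = slid⁺ (inj₁ (e , ¬j))

  ab′ : Edge slid a b
  ab′ = keep ab λ { (inj₁ (_ , b≡s)) → b≢s b≡s ; (inj₂ (a≡s , _)) → a≢s a≡s }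

  edge-off-b : ∀ {u v} → Edge slid u v → u ≢ b → v ≢ b → Edge T u v
  edge-off-b e u≢b v≢b with slid⁻ e
  ... | inj₁ (f , _) = f
  ... | inj₂ (inj₁ (u≡b , _)) = contradiction u≡b u≢b
  ... | inj₂ (inj₂ (_ , v≡b)) = contradiction v≡b v≢b

  not-as : ¬ Edge slid a s
  not-as e with slid⁻ e
  ... | inj₁ (_ , ¬j) = ¬j (inj₁ (refl , refl))
  ... | inj₂ (inj₁ (eq , _)) = a≢b eq
  ... | inj₂ (inj₂ (eq , _)) = a≢s eq

  at-a : ∀ {u} → Edge slid a u → Edge T a u × u ≢ s
  at-a e with slid⁻ e
  ... | inj₁ (f , ¬j) = f , λ { refl → ¬j (inj₁ (refl , refl)) }
  ... | inj₂ (inj₁ (eq , _)) = contradiction eq a≢b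
  ... | inj₂ (inj₂ (eq , _)) = contradiction eq a≢s

  at-b : ∀ {u} → Edge slid b u → Edge T b u ⊎ u ≡ s
  at-b e with slid⁻ e
  ... | inj₁ (f , _) = inj₁ f
  ... | inj₂ (inj₁ (_ , eq)) = inj₂ eq
  ... | inj₂ (inj₂ (eq , _)) = contradiction eq b≢s

  at-s : ∀ {u} → Edge slid s u → u ≢ a × (Edge T s u ⊎ u ≡ b)
  at-s e with slid⁻ e
  ... | inj₁ (f , ¬j) = (λ { refl → ¬j (inj₂ (refl , refl)) }) , inj₁ f
  ... | inj₂ (inj₁ (eq , _)) = contradiction (≡.sym eq) b≢s
  ... | inj₂ (inj₂ (_ , refl)) = (a≢b ∘ ≡.sym) , inj₂ refl

  elsewhere : ∀ {z u} → z ≢ b → z ≢ s → Edge slid z u → Edge T z u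
  elsewhere z≢b z≢s e with slid⁻ e
  ... | inj₁ (f , _) = f
  ... | inj₂ (inj₁ (eq , _)) = contradiction eq z≢b
  ... | inj₂ (inj₂ (eq , _)) = contradiction eq z≢s

  -- The deleted edge `as` is replaced by the detour over `b`; in the other direction, `bs` is
  -- replaced by the detour over `a`.
  walk⁺ : ∀ {Q x y} → Q b → Walk T Q x y → Walk slid Q x y
  walk⁺ {Q} qb = simulate id detour
    where
    detour : ∀ {u v} → Q u → Q v → Edge T u v → Walk slid Q u v
    detour {u} {v} qu qv e with joins? a s u v
    ... | no ¬j = step qu (keep e ¬j) (stop qv)
    ... | yes (inj₁ (refl , refl)) = step qu ab′ (step qb bs′ (stop qv))
    ... | yes (inj₂ (refl , refl)) = step qu (edge-sym slid bs′) (step qb (edge-sym slid ab′) (stop qv))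

  walk⁻ : ∀ {Q x y} → Q a → Walk slid Q x y → Walk T Q x y
  walk⁻ {Q} qa = simulate id detour
    where
    detour : ∀ {u v} → Q u → Q v → Edge slid u v → Walk T Q u v
    detour qu qv e with slid⁻ e
    ... | inj₁ (f , _) = step qu f (stop qv)
    ... | inj₂ (inj₁ (refl , refl)) = step qu (edge-sym T ab) (step qa as (stop qv))
    ... | inj₂ (inj₂ (refl , refl)) = step qu (edge-sym T as) (step qa ab (stop qv))

  -- Away from `a`, only the new edge `bs` joins different components of the old tree without `a`,
  -- those of `b` and of `s`. A walk that uses it has both ends in these two components.
  around-a : ∀ {x y} → Avoiding slid a x y → Avoiding T a x y
    ⊎ ((Avoiding T a x b ⊎ Avoiding T a x s) × (Avoiding T a y b ⊎ Avoiding T a y s))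
  around-a (stop q) = inj₁ (stop q)
  around-a (step q e w) with slid⁻ e | around-a w
  ... | inj₁ (f , _) | inj₁ v = inj₁ (step q f v)
  ... | inj₁ (f , _) | inj₂ (inj₁ v , c) = inj₂ (inj₁ (step q f v) , c)
  ... | inj₁ (f , _) | inj₂ (inj₂ v , c) = inj₂ (inj₂ (step q f v) , c)
  ... | inj₂ (inj₁ (refl , refl)) | inj₁ v = inj₂ (inj₁ (stop q) , inj₂ (reverseʷ v))
  ... | inj₂ (inj₁ (refl , refl)) | inj₂ (_ , c) = inj₂ (inj₁ (stop q) , c)
  ... | inj₂ (inj₂ (refl , refl)) | inj₁ v = inj₂ (inj₂ (stop q) , inj₁ (reverseʷ v))
  ... | inj₂ (inj₂ (refl , refl)) | inj₂ (_ , c) = inj₂ (inj₂ (stop q) , c)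

  off-b : ∀ {Q x y} → (∀ {z} → Q z → z ≢ b) → Walk slid Q x y → Walk T Q x y
  off-b q≢b = simulate id λ qu qv e → step qu (edge-off-b e (q≢b qu) (q≢b qv)) (stop qv)

  off-a : ∀ {x y} → Avoiding T a x y → Avoiding slid a x y
  off-a = simulate id λ qu qv e → step qu
    (keep e λ { (inj₁ (eq , _)) → qu eq ; (inj₂ (_ , eq)) → qv eq }) (stop qv)

  -- Only `a`, `b` and `s` change their neighbourhoods: `a` loses `s`, `b` gains `s`, and `s`
  -- exchanges `a` for `b`. At any other vertex the walk is pulled back to `T` directly.
  slid-acyclic : Acyclic slid
  slid-acyclic {z} {x} {y} zx zy x≢y w with z ≟ a | z ≟ b | z ≟ s
  slid-acyclic zx zy x≢y w | yes refl | _ | _ with at-a zx | at-a zy | around-a w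
  ... | ax , _ | ay , _ | inj₁ v = acyclic ax ay x≢y v
  ... | ax , x≢s | ay , y≢s | inj₂ (cx , cy) = x≢y (≡.trans (is-b ax x≢s cx) (≡.sym (is-b ay y≢s cy)))
    where
    is-b : ∀ {u} → Edge T a u → u ≢ s → Avoiding T a u b ⊎ Avoiding T a u s → u ≡ b
    is-b {u} au u≢s c with u ≟ b | c
    ... | yes eq | _ = eq
    ... | no u≢b | inj₁ v = contradiction v (acyclic au ab u≢b)
    ... | no _ | inj₂ v = contradiction v (acyclic au as u≢s)
  slid-acyclic zx zy x≢y w | no _ | yes refl | _ = go (at-b zx) (at-b zy) w x≢y
    where
    from-s : ∀ {y} → Edge T b y → y ≢ s → ¬ Avoiding slid b s y
    from-s {y} by y≢s w with y ≟ a
    ... | no y≢a = acyclic (edge-sym T ab) by (y≢a ∘ ≡.sym)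
      (step a≢b as (off-b id w))
    -- The edge `as` is gone, so the walk enters `a` from a neighbour `c` other than `s`; then `s`
    -- and `c` are joined around `a` in `T`.
    ... | yes refl with firstHit w (a≢s ∘ ≡.sym)
    ... | c , ca , v = acyclic as (edge-sym T (edge-off-b ca (proj₁ (walk-end v)) a≢b))
      (λ { refl → not-as (edge-sym slid ca) }) (mapʷ proj₂ (off-b proj₁ v))
    go : ∀ {x y} → Edge T b x ⊎ x ≡ s → Edge T b y ⊎ y ≡ s → Avoiding slid b x y → x ≢ y → ⊥
    go (inj₁ bx) (inj₁ by) w x≢y = acyclic bx by x≢y (off-b id w)
    go (inj₁ bx) (inj₂ refl) w x≢y = from-s bx x≢y (reverseʷ w)
    go (inj₂ refl) (inj₁ by) w x≢y = from-s by (x≢y ∘ ≡.sym) w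
    go (inj₂ refl) (inj₂ refl) w x≢y = x≢y refl
  slid-acyclic zx zy x≢y w | no z≢a | no z≢b | no z≢s =
    acyclic (elsewhere z≢b z≢s zx) (elsewhere z≢b z≢s zy) x≢y (walk⁻ (z≢a ∘ ≡.sym) w)
  slid-acyclic zx zy x≢y w | no z≢a | no z≢b | yes refl =
    go (at-s zx) (at-s zy) (walk⁻ a≢s w) x≢y
    where
    bridge : Avoiding T s b a
    bridge = step b≢s (edge-sym T ab) (stop a≢s)
    go : ∀ {x y} → x ≢ a × (Edge T s x ⊎ x ≡ b) → y ≢ a × (Edge T s y ⊎ y ≡ b)
      → Avoiding T s x y → x ≢ y → ⊥
    go (_ , inj₁ sx) (_ , inj₁ sy) w x≢y = acyclic sx sy x≢y w
    go (x≢a , inj₁ sx) (_ , inj₂ refl) w _ = acyclic sx (edge-sym T as) x≢a (w ++ʷ bridge)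
    go (_ , inj₂ refl) (y≢a , inj₁ sy) w _ = acyclic sy (edge-sym T as) y≢a (reverseʷ w ++ʷ bridge)
    go (_ , inj₂ refl) (_ , inj₂ refl) _ x≢y = x≢y refl

  slid-tree : IsTree slid
  slid-tree = mkTree (proj₁ isTree) (λ x y → walk⁺ tt (connect x y)) slid-acyclic

  private module T′ = Tree slid-tree

  module _ {x y p p′} (pf : PathFromTo T x y p) (pf′ : PathFromTo slid x y p′) where

    other⁺ : ∀ {z} → z ≢ b → z ∈ p → z ≢ a → z ∈ p′
    other⁺ z≢b z∈ z≢a = T′.not-avoiding⇒∈ pf′ (separates pf z∈ ∘ walk⁻ (z≢a ∘ ≡.sym))

    other⁻ : ∀ {z} → z ≢ b → z ∈ p′ → z ∈ p
    other⁻ {z} z≢b z∈ with z ≟ a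
    ... | yes refl = not-avoiding⇒∈ pf (T′.separates pf′ z∈ ∘ off-a)
    ... | no _ = not-avoiding⇒∈ pf (T′.separates pf′ z∈ ∘ walk⁺ (z≢b ∘ ≡.sym))

    b⁺ : b ∈ p → b ∈ p′
    b⁺ b∈ = T′.not-avoiding⇒∈ pf′ (separates pf b∈ ∘ off-b id)

    b⁻ : b ∈ p′ → b ∈ p ⊎ (a ∈ p × s ∈ p)
    b⁻ b∈ with b ∈? p | a ∈? p ×-dec s ∈? p
    ... | yes c | _ = inj₁ c
    ... | _ | yes c = inj₂ c
    ... | no b∉ | no ¬as = contradiction
      (simulate (λ z∈ eq → b∉ (subst (_∈ p) eq z∈)) copy (within pf (start-∈ pf) (end-∈ pf)))
      (T′.separates pf′ b∈)
      where
      copy : ∀ {u v} → u ∈ p → v ∈ p → Edge T u v → Avoiding slid b u v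
      copy u∈ v∈ e = step (λ { refl → b∉ u∈ })
        (keep e λ { (inj₁ (refl , refl)) → ¬as (u∈ , v∈) ; (inj₂ (refl , refl)) → ¬as (v∈ , u∈) })
        (stop λ { refl → b∉ v∈ })

    -- The new path can bypass `a` only over `bs`, so its ends lie one each in the components of `b`
    -- and `s`; the old path therefore enters `a` from one of these two and leaves through the
    -- other.
    a-lost : a ∈ p → a ∉ p′ → b ∈ p × s ∈ p
    a-lost a∈ a∉ with around-a (avoid pf′ a∉ (start-∈ pf′) (end-∈ pf′))
    ... | inj₁ w = contradiction w (separates pf a∈)
    ... | inj₂ (inj₁ v , inj₁ w) = contradiction (v ++ʷ reverseʷ w) (separates pf a∈)
    ... | inj₂ (inj₂ v , inj₂ w) = contradiction (v ++ʷ reverseʷ w) (separates pf a∈)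
    ... | inj₂ (inj₁ v , inj₂ w) = neighbour-∈ pf a∈ ab v , reverse-∈ pr pf (neighbour-∈ pr (reverse-∈ pf pr a∈) as w)
      where pr = path-ok y x
    ... | inj₂ (inj₂ v , inj₁ w) = reverse-∈ pr pf (neighbour-∈ pr (reverse-∈ pf pr a∈) ab w) , neighbour-∈ pf a∈ as v
      where pr = path-ok y x

    a-skipped : a ∈ p → b ∈ p → s ∈ p → a ∉ p′
    a-skipped a∈ b∈ s∈ a∈′ with side pf a b∈ (a≢b ∘ ≡.sym) | side pf a s∈ (a≢s ∘ ≡.sym)
    ... | inj₁ v | inj₁ w = acyclic ab as b≢s (reverseʷ v ++ʷ w)
    ... | inj₂ v | inj₂ w = acyclic ab as b≢s (v ++ʷ reverseʷ w)
    ... | inj₁ v | inj₂ w = T′.separates pf′ a∈′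
      (off-a v ++ʷ step (a≢b ∘ ≡.sym) bs′ (off-a w))
    ... | inj₂ v | inj₁ w = T′.separates pf′ a∈′
      (off-a w ++ʷ step (a≢s ∘ ≡.sym) (edge-sym slid bs′) (off-a v))

module Leaf {k} {T : Graph k} (isTree : IsTree T) (q : Fin k) where

  open Tree isTree

  Leafed : Fin (suc k) → Fin (suc k) → Set
  Leafed zero zero = ⊥
  Leafed zero (suc y) = y ≡ q
  Leafed (suc x) zero = x ≡ q
  Leafed (suc x) (suc y) = Edge T x y

  private
    leafed? : ∀ x y → Dec (Leafed x y)
    leafed? zero zero = no id
    leafed? zero (suc y) = y ≟ q
    leafed? (suc x) zero = x ≟ q
    leafed? (suc x) (suc y) = edge? T x y

    leafed-sym : ∀ {x y} → Leafed x y → Leafed y x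
    leafed-sym {zero} {suc _} e = e
    leafed-sym {suc _} {zero} e = e
    leafed-sym {suc _} {suc _} e = edge-sym T e

    leafed-irrefl : ∀ {x} → ¬ Leafed x x
    leafed-irrefl {suc _} e = edge-≢ T e refl

  open FromRelation Leafed leafed? (λ {x} → leafed-sym {x}) (λ {x} → leafed-irrefl {x}) public
    renaming (graph to leafed; edge⁺ to leafed⁺; edge⁻ to leafed⁻)

  at-leaf : ∀ {y} → Edge leafed zero y → y ≡ suc q
  at-leaf {zero} e = ⊥-elim (leafed⁻ e)
  at-leaf {suc _} e = cong suc (leafed⁻ e)

  leaf-edge : Edge leafed zero (suc q)
  leaf-edge = leafed⁺ refl

  lift : ∀ {Q : Fin k → Set} {Q′ : Fin (suc k) → Set} {x y} → (∀ {z} → Q z → Q′ (suc z))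
    → Walk T Q x y → Walk leafed Q′ (suc x) (suc y)
  lift f (stop q) = stop (f q)
  lift f (step q e w) = step (f q) (leafed⁺ e) (lift f w)

  lower : ∀ {Q : Fin k → Set} {Q′ : Fin (suc k) → Set} {x y} → (∀ {z} → Q′ (suc z) → Q z)
    → Walk leafed Q′ (suc x) (suc y) → Walk T Q x y
  lower f (stop q) = stop (f q)
  lower f (step {y = suc _} q e w) = step (f q) (leafed⁻ e) (lower f w)
  -- A visit to the leaf starts and ends at `q`, so it is cut out.
  lower {x = x} f (step {y = zero} _ e (step _ e′ w)) with at-leaf (edge-sym leafed e) | at-leaf e′
  ... | refl | refl = lower f w

  leafed-acyclic : Acyclic leafed
  leafed-acyclic {zero} zx zy x≢y _ = x≢y (≡.trans (at-leaf zx) (≡.sym (at-leaf zy)))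
  leafed-acyclic {suc z} {zero} {zero} _ _ x≢y _ = x≢y refl
  leafed-acyclic {suc z} {zero} {suc _} zx _ _ (step _ e w) with at-leaf (edge-sym leafed zx)
  ... | refl = walk-start w (at-leaf e)
  leafed-acyclic {suc z} {suc _} {zero} _ zy _ w with at-leaf (edge-sym leafed zy) | reverseʷ w
  ... | refl | step _ e w′ = walk-start w′ (at-leaf e)
  leafed-acyclic {suc z} {suc _} {suc _} zx zy x≢y w =
    acyclic (leafed⁻ zx) (leafed⁻ zy) (λ { refl → x≢y refl }) (lower (λ { q refl → q refl }) w)

  leafed-tree : IsTree leafed
  leafed-tree = mkTree (s≤s z≤n) conn leafed-acyclic
    where
    conn : ∀ x y → Walk leafed (λ _ → ⊤) x y
    conn zero zero = stop tt
    conn zero (suc y) = step tt leaf-edge (lift id (connect q y))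
    conn (suc x) zero = lift id (connect x q) ++ʷ step tt (edge-sym leafed leaf-edge) (stop tt)
    conn (suc x) (suc y) = lift id (connect x y)

  private module T⁺ = Tree leafed-tree

  module _ {x y p p′} (pf : PathFromTo T x y p) (pf′ : PathFromTo leafed (suc x) (suc y) p′) where

    suc⁺ : ∀ {z} → z ∈ p → suc z ∈ p′
    suc⁺ z∈ = T⁺.not-avoiding⇒∈ pf′ (separates pf z∈ ∘ lower λ { q refl → q refl })

    suc⁻ : ∀ {z} → suc z ∈ p′ → z ∈ p
    suc⁻ z∈ = not-avoiding⇒∈ pf (T⁺.separates pf′ z∈ ∘ lift λ { q refl → q refl })

    leaf-∉ : zero ∉ p′
    leaf-∉ z∈ = T⁺.separates pf′ z∈ (lift (λ { _ () }) (connect x y))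

-- Contracting representations

-- The ends are part of the data because surgery fixes them and redefines each route as the path
-- between them in the new host.
record Rep {n} (G : Graph n) (k : ℕ) : Set where
  field
    host    : Graph k
    isTree  : IsTree host
    x₀ y₀   : Fin n → Fin k
    route   : Fin n → List (Fin k)
    isRoute : ∀ v → PathFromTo host (x₀ v) (y₀ v) (route v)
    rep⁺    : ∀ {u v} → u ≢ v → Edge G u v → Share (route u) (route v)
    rep⁻    : ∀ {u v} → u ≢ v → Share (route u) (route v) → Edge G u v

isPath⇒ends : ∀ {k} (T : Graph k) p → IsPath T p → ∃ λ x → ∃ λ y → PathFromTo T x y p
isPath⇒ends T (x ∷ xs) ok = x , proj₁ (final x xs) , ok , refl , proj₂ (final x xs)
  where
  final : ∀ {k} (x : Fin k) xs → ∃ λ y → last (x ∷ xs) ≡ just y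
  final x [] = x , refl
  final _ (x ∷ xs) = final x xs

fromVPT : ∀ {n} {G : Graph n} (R : VPTRep G) → Rep G (VPTRep.m R)
fromVPT R = record
  { host = VPTRep.T R
  ; isTree = VPTRep.tree R
  ; x₀ = λ v → proj₁ (ends v)
  ; y₀ = λ v → proj₁ (proj₂ (ends v))
  ; route = VPTRep.P R
  ; isRoute = λ v → proj₂ (proj₂ (ends v))
  ; rep⁺ = λ {u} {v} u≢v → Equivalence.to (VPTRep.rep R u v u≢v)
  ; rep⁻ = λ {u} {v} u≢v → Equivalence.from (VPTRep.rep R u v u≢v)
  }
  where ends = λ v → isPath⇒ends (VPTRep.T R) (VPTRep.P R v) (VPTRep.paths R v)

toVPT : ∀ {n} {G : Graph n} {k} → Rep G k → VPTRep G
toVPT {k = k} R = record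
  { m = k
  ; T = host
  ; tree = isTree
  ; P = route
  ; paths = λ v → isPath (route v) (isRoute v)
  ; rep = λ u v u≢v → mk⇔ (rep⁺ u≢v) (rep⁻ u≢v)
  }
  where
  open Rep R
  isPath : ∀ {x y} p → PathFromTo host x y p → IsPath host p
  isPath (_ ∷ _) (ok , _) = ok

-- Once no host edge can be contracted, every branch at b that is used starts with a vertex a lying on
-- a route that avoids b.
Reduced : ∀ {n} {G : Graph n} {k} → Rep G k → Set
Reduced R = ∀ {a b} → Edge host a b → (∃ λ v → a ∈ route v × b ∉ route v) ⊎ (∀ v → a ∉ route v)
  where open Rep R

module Reduction {n} {G : Graph n} {k : ℕ} where

  Smaller : Rep G k → Rep G k → Set
  Smaller R′ R = (∀ v {z} → z ∈ Rep.route R′ v → z ∈ Rep.route R v)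
    × ∃ λ v → ∃ λ z → z ∈ Rep.route R v × z ∉ Rep.route R′ v

  module _ (R : Rep G k) {a b} (ab : Edge (Rep.host R) a b)
    (a⇒b : ∀ {v} → a ∈ Rep.route R v → b ∈ Rep.route R v) where

    open Rep R
    open Tree isTree

    private
      -- Routes that meet at `a` also meet at `b`, so taking routes off `a` destroys no
      -- intersection.
      share-off-a : ∀ {p q : Fin n → List (Fin k)} → (∀ v {z} → z ∈ route v → z ≢ a → z ∈ p v)
        → ∀ {u v} → Share (route u) (route v) → Share (p u) (p v)
      share-off-a {p} f {u} {v} (z , z∈u , z∈v) with z ≟ a
      ... | yes refl = b , f u (a⇒b z∈u) b≢a , f v (a⇒b z∈v) b≢a
        where b≢a = edge-≢ host ab ∘ ≡.sym
      ... | no z≢a = z , f u z∈u z≢a , f v z∈v z≢a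

      share-⊆ : ∀ {p : Fin n → List (Fin k)} → (∀ v {z} → z ∈ p v → z ∈ route v)
        → ∀ {u v} → Share (p u) (p v) → Share (route u) (route v)
      share-⊆ f {u} {v} (z , z∈u , z∈v) = z , f u z∈u , f v z∈v

    trim : ∀ {v₀ y p} → PathFromTo host a y p
      → (∀ {z} → z ∈ p → z ∈ route v₀) → (∀ {z} → z ∈ route v₀ → z ∈ p)
      → ∃ λ R′ → Smaller R′ R
    trim {v₀} {y} {p} pf p⊆ ⊆p = record
      { host = host
      ; isTree = isTree
      ; x₀ = λ v → proj₁ (new v)
      ; y₀ = λ v → proj₁ (proj₂ (new v))
      ; route = route′
      ; isRoute = λ v → proj₂ (proj₂ (proj₂ (new v)))
      ; rep⁺ = λ u≢v e → share-off-a {route′} {route′} keeps (rep⁺ u≢v e)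
      ; rep⁻ = λ u≢v s → rep⁻ u≢v (share-⊆ shrinks s)
      } , shrinks , v₀ , a , p⊆ (start-∈ pf) , a-gone
      where
      new : Fin n → ∃ λ x → ∃ λ y → ∃ λ p → PathFromTo host x y p
      new v with v ≟ v₀
      ... | yes _ = b , y , path b y , path-ok b y
      ... | no _ = x₀ v , y₀ v , route v , isRoute v
      route′ : Fin n → List (Fin k)
      route′ v = proj₁ (proj₂ (proj₂ (new v)))
      b∈ : b ∈ p
      b∈ = ⊆p (a⇒b (p⊆ (start-∈ pf)))
      shrinks : ∀ v {z} → z ∈ route′ v → z ∈ route v
      shrinks v {z} z∈ with v ≟ v₀
      ... | no _ = z∈
      ... | yes refl with z ∈? p
      ... | yes z∈p = p⊆ z∈p
      ... | no z∉ = contradiction (avoid pf z∉ b∈ (end-∈ pf)) (separates (path-ok b y) z∈)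
      keeps : ∀ v {z} → z ∈ route v → z ≢ a → z ∈ route′ v
      keeps v z∈ z≢a with v ≟ v₀
      ... | no _ = z∈
      ... | yes refl = not-avoiding⇒∈ (path-ok b y) λ w →
        separates pf (⊆p z∈) (step (z≢a ∘ ≡.sym) ab w)
      a-gone : a ∉ route′ v₀
      a-gone a∈ with v₀ ≟ v₀
      ... | no neq = neq refl
      ... | yes _ with side pf a b∈ (edge-≢ host ab ∘ ≡.sym)
      ... | inj₁ w = walk-start w refl
      ... | inj₂ w = separates (path-ok b y) a∈ w

    -- A slide adds `b` only to routes through `a`, which contain `b` already, and takes off `a`
    -- exactly the routes that pass it between `b` and `s`.
    slideOff : ∀ {s v₀} → Edge host a s → b ≢ s → a ∈ route v₀ → s ∈ route v₀
      → ∃ λ R′ → Smaller R′ R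
    slideOff {s} {v₀} as b≢s a∈ s∈ = record
      { host = slid
      ; isTree = slid-tree
      ; x₀ = x₀
      ; y₀ = y₀
      ; route = route′
      ; isRoute = isRoute′
      ; rep⁺ = λ u≢v e → share-off-a {route′} {route′} keeps (rep⁺ u≢v e)
      ; rep⁻ = λ u≢v s → rep⁻ u≢v (share-⊆ shrinks s)
      } , shrinks , v₀ , a , a∈ , a-skipped (isRoute v₀) (isRoute′ v₀) a∈ (a⇒b a∈) s∈
      where
      open Slide isTree a b s ab as b≢s
      route′ = λ v → Tree.path slid-tree (x₀ v) (y₀ v)
      isRoute′ = λ v → Tree.path-ok slid-tree (x₀ v) (y₀ v)
      shrinks : ∀ v {z} → z ∈ route′ v → z ∈ route v
      shrinks v {z} z∈ with z ≟ b
      ... | no z≢b = other⁻ (isRoute v) (isRoute′ v) z≢b z∈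
      ... | yes refl with b⁻ (isRoute v) (isRoute′ v) z∈
      ... | inj₁ b∈ = b∈
      ... | inj₂ (a∈ , _) = a⇒b a∈
      keeps : ∀ v {z} → z ∈ route v → z ≢ a → z ∈ route′ v
      keeps v {z} z∈ z≢a with z ≟ b
      ... | no z≢b = other⁺ (isRoute v) (isRoute′ v) z≢b z∈ z≢a
      ... | yes refl = b⁺ (isRoute v) (isRoute′ v) z∈

    shrink : ∀ {v₀} → a ∈ route v₀ → ∃ λ R′ → Smaller R′ R
    shrink {v₀} a∈ with x₀ v₀ ≟ a | y₀ v₀ ≟ a
    ... | yes refl | _ = trim {v₀} (isRoute v₀) id id
    ... | no _ | yes refl = trim {v₀} pr (reverse-∈ pr (isRoute v₀)) (reverse-∈ (isRoute v₀) pr)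
      where pr = path-ok (y₀ v₀) (x₀ v₀)
    -- Now `a` is interior to the route, and one of its two neighbours there differs from `b`; that
    -- neighbour is slid.
    ... | no x≢a | no y≢a
      with firstHit (within (isRoute v₀) (start-∈ (isRoute v₀)) a∈) x≢a
         | firstHit (within (isRoute v₀) (end-∈ (isRoute v₀)) a∈) y≢a
    ... | c , ca , w | d , da , w′ with b ≟ c
    ... | no b≢c = slideOff (edge-sym host ca) b≢c a∈ (proj₁ (walk-end w))
    ... | yes refl = slideOff (edge-sym host da) (λ { refl →
        separates (isRoute v₀) a∈ (mapʷ proj₂ w ++ʷ reverseʷ (mapʷ proj₂ w′)) })
        a∈ (proj₁ (walk-end w′))

  reducible? : (R : Rep G k) → Reduced R ⊎ ∃ λ R′ → Smaller R′ R
  reducible? R with any? (λ a → any? (λ b → edge? (Rep.host R) a b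
    ×-dec (any? (λ v → a ∈? Rep.route R v)
    ×-dec all? (λ v → (a ∈? Rep.route R v) →-dec (b ∈? Rep.route R v)))))
  ... | yes (a , b , ab , (v , a∈) , a⇒b) = inj₂ (shrink R ab (λ {v} → a⇒b v) a∈)
  ... | no none = inj₁ reduced
    where
    open Rep R
    reduced : Reduced R
    reduced {a} {b} ab with any? (λ v → (a ∈? route v) ×-dec ¬? (b ∈? route v)) | any? (λ v → a ∈? route v)
    ... | yes found | _ = inj₁ found
    ... | no _ | no unused = inj₂ λ v a∈ → unused (v , a∈)
    ... | no ¬found | yes used = contradiction (a , b , ab , used , λ v a∈ →
      decidable-stable (b ∈? route v) λ b∉ → ¬found (v , a∈ , b∉)) none

  reduce : Rep G k → ∃ λ (R : Rep G k) → Reduced R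
  reduce R = go _ R (cartesianProduct (allFin n) (allFin k)) ≤-refl
    λ v z _ → ∈-cartesianProduct⁺ (∈-allFin v) (∈-allFin z)
    where
    go : ∀ fuel (R : Rep G k) (L : List (Fin n × Fin k)) → length L < fuel
      → (∀ v z → z ∈ Rep.route R v → (v , z) ∈ L) → ∃ λ (R : Rep G k) → Reduced R
    go (suc fuel) R L (s≤s L≤) covers with reducible? R
    ... | inj₁ reduced = R , reduced
    ... | inj₂ (R′ , shrinks , v , z , z∈ , z∉) =
      go fuel R′ (filter new? L)
        (<-≤-trans (filter-notAll new? L (Any.map (λ eq z∈′ → z∉ (subst holds (≡.sym eq) z∈′)) (covers v z z∈))) L≤)
        λ v z z∈ → ∈-filter⁺ new? (covers v z (shrinks v z∈)) z∈
      where
      holds : Fin n × Fin k → Set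
      holds (v , z) = z ∈ Rep.route R′ v
      new? : ∀ vz → Dec (holds vz)
      new? (v , z) = z ∈? Rep.route R′ v

-- Splitting along colourings of branches

-- Numbers the neighbours counted by `degree`. This serves twice: to bound a degree by an injective
-- colouring, and to turn branches at a vertex into colours.
nth : ∀ {k} (f : Fin k → Bool) → Fin ∣ tabulate f ∣ → Fin k
nth {suc k} f i with f zero
nth {suc k} f zero | true = zero
nth {suc k} f (suc i) | true = suc (nth (f ∘ suc) i)
nth {suc k} f i | false = suc (nth (f ∘ suc) i)

nth-true : ∀ {k} (f : Fin k → Bool) i → f (nth f i) ≡ true
nth-true {suc k} f i with f zero in eq
nth-true {suc k} f zero | true = eq
nth-true {suc k} f (suc i) | true = nth-true (f ∘ suc) i
nth-true {suc k} f i | false = nth-true (f ∘ suc) i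

nth-injective : ∀ {k} (f : Fin k → Bool) {i j} → nth f i ≡ nth f j → i ≡ j
nth-injective {suc k} f {i} {j} eq with f zero
nth-injective {suc k} f {zero} {zero} eq | true = refl
nth-injective {suc k} f {suc i} {suc j} eq | true =
  cong suc (nth-injective (f ∘ suc) (suc-injective eq))
nth-injective {suc k} f eq | false = nth-injective (f ∘ suc) (suc-injective eq)

rank : ∀ {k} (f : Fin k → Bool) x → f x ≡ true → ∃ λ i → nth f i ≡ x
rank {suc k} f x fx with f zero in eq
rank {suc k} f zero fx | true = zero , refl
rank {suc k} f (suc x) fx | true with i , nth-i ← rank (f ∘ suc) x fx = suc i , cong suc nth-i
rank {suc k} f zero fx | false = contradiction (≡.trans (≡.sym fx) eq) λ ()
rank {suc k} f (suc x) fx | false with i , nth-i ← rank (f ∘ suc) x fx = i , cong suc nth-i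

module _ {n} {G : Graph n} {h : ℕ} where

  -- c r t is the colour of the branch at r that starts with its neighbour t.
  Proper : ∀ {k} → Rep G k → (Fin k → Fin k → Fin h) → Set
  Proper R c = ∀ {r t t′} → Edge host r t → Edge host r t′ → t ≢ t′ → c r t ≡ c r t′
    → ∀ v → r ∈ route v → t ∈ route v → t′ ∉ route v
    where open Rep R

  -- Directed host edges outside L get distinct colours at their origin; each split shortens L.
  Clash : ∀ {k} → Rep G k → (Fin k → Fin k → Fin h) → List (Fin k × Fin k) → Set
  Clash R c L = ∀ {r t t′} → Edge host r t → Edge host r t′ → t ≢ t′ → c r t ≡ c r t′
    → (r , t) ∈ L ⊎ (r , t′) ∈ L
    where open Rep R

  clash-tail : ∀ {k} (R : Rep G k) {c} {r t L} → Clash R c ((r , t) ∷ L) → ¬ Edge (Rep.host R) r t → Clash R c L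
  clash-tail R clash ¬e e e′ t≢t′ eq with clash e e′ t≢t′ eq
  ... | inj₁ (here refl) = contradiction e ¬e
  ... | inj₂ (here refl) = contradiction e′ ¬e
  ... | inj₁ (there ∈L) = inj₁ ∈L
  ... | inj₂ (there ∈L) = inj₂ ∈L

  no-clash⇒degree : ∀ {k} (R : Rep G k) {c} → Clash R c [] → MaxDegree≤ (Rep.host R) h
  no-clash⇒degree R {c} clash r = injective⇒≤ {f = c r ∘ nth (adj host r)} injective
    where
    open Rep R
    injective : ∀ {i j} → c r (nth (adj host r) i) ≡ c r (nth (adj host r) j) → i ≡ j
    injective {i} {j} eq with nth (adj host r) i ≟ nth (adj host r) j
    ... | yes same = nth-injective (adj host r) same
    ... | no ¬same with clash (nth-true (adj host r) i) (nth-true (adj host r) j) ¬same eq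
    ... | inj₁ ()
    ... | inj₂ ()

  module SlideColoured {k} (R : Rep G k) (c : Fin k → Fin k → Fin h) (proper : Proper R c)
    (a b s : Fin k) (ab : Edge (Rep.host R) a b) (as : Edge (Rep.host R) a s) (b≢s : b ≢ s)
    (c-eq : c a b ≡ c a s) (b⇒a : ∀ {v} → b ∈ Rep.route R v → a ∈ Rep.route R v) where

    open Rep R
    open Slide isTree a b s ab as b≢s

    route′ : Fin n → List (Fin k)
    route′ v = Tree.path slid-tree (x₀ v) (y₀ v)

    isRoute′ : ∀ v → PathFromTo slid (x₀ v) (y₀ v) (route′ v)
    isRoute′ v = Tree.path-ok slid-tree (x₀ v) (y₀ v)

    private
      -- A slide removes `a` only from a route through both `b` and `s`; such a route is excluded by
      -- properness, these two having the same colour at `a`.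
      a-kept : ∀ {v} → a ∈ route v → a ∈ route′ v
      a-kept {v} a∈ with a ∈? route′ v
      ... | yes a∈′ = a∈′
      ... | no a∉ with b∈ , s∈ ← a-lost (isRoute v) (isRoute′ v) a∈ a∉ =
        contradiction s∈ (proper ab as b≢s c-eq v a∈ b∈)

      kept : ∀ {v z} → z ∈ route v → z ∈ route′ v
      kept {v} {z} z∈ with z ≟ a | z ≟ b
      ... | yes refl | _ = a-kept z∈
      ... | no _ | yes refl = b⁺ (isRoute v) (isRoute′ v) z∈
      ... | no z≢a | no z≢b = other⁺ (isRoute v) (isRoute′ v) z≢b z∈ z≢a

      b⇒a-old : ∀ {v} → b ∈ route′ v → a ∈ route v
      b⇒a-old {v} b∈ with b⁻ (isRoute v) (isRoute′ v) b∈
      ... | inj₁ b∈ = b⇒a b∈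
      ... | inj₂ (a∈ , _) = a∈

      -- The only vertex a route can gain is `b`, and all routes through `b` already met at `a`.
      unkept : ∀ {u v} → Share (route′ u) (route′ v) → Share (route u) (route v)
      unkept {u} {v} (z , z∈u , z∈v) with z ≟ b
      ... | yes refl = a , b⇒a-old z∈u , b⇒a-old z∈v
      ... | no z≢b = z , other⁻ (isRoute u) (isRoute′ u) z≢b z∈u , other⁻ (isRoute v) (isRoute′ v) z≢b z∈v

    slidRep : Rep G k
    slidRep = record
      { host = slid
      ; isTree = slid-tree
      ; x₀ = x₀
      ; y₀ = y₀
      ; route = route′
      ; isRoute = isRoute′
      ; rep⁺ = λ {u} {v} u≢v e → let z , z∈u , z∈v = rep⁺ u≢v e in z , kept {u} z∈u , kept {v} z∈v
      ; rep⁻ = λ {u} {v} u≢v s → rep⁻ u≢v (unkept {u} {v} s)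
      }

    slid-b⇒a : ∀ {v} → b ∈ route′ v → a ∈ route′ v
    slid-b⇒a {v} = a-kept {v} ∘ b⇒a-old {v}

    back : Fin k → Fin k → Fin k
    back r t with (r ≟ s) ×-dec (t ≟ b)
    ... | yes _ = a
    ... | no _ = t

    forth : Fin k × Fin k → Fin k × Fin k
    forth (r , t) with (r ≟ s) ×-dec (t ≟ a)
    ... | yes _ = r , b
    ... | no _ = r , t

    back-id : ∀ {r t} → r ≢ s → back r t ≡ t
    back-id {r} {t} r≢s with (r ≟ s) ×-dec (t ≟ b)
    ... | yes (eq , _) = contradiction eq r≢s
    ... | no _ = refl

    forth-id : ∀ {r t} → r ≢ s → forth (r , t) ≡ (r , t)
    forth-id {r} {t} r≢s with (r ≟ s) ×-dec (t ≟ a)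
    ... | yes (eq , _) = contradiction eq r≢s
    ... | no _ = refl

    -- At `s`, the new neighbour `b` inherits the colour of `a`. At `b`, the new edge has the colour
    -- `c b s`, which is prescribed beforehand since `c` is defined on non-edges too.
    slidColour : Fin k → Fin k → Fin h
    slidColour r t = c r (back r t)

    private
      forth-back : ∀ {r t} → Edge slid r t → forth (r , back r t) ≡ (r , t)
      forth-back {r} {t} e with (r ≟ s) ×-dec (t ≟ b)
      forth-back {r} {t} e | yes (refl , refl) with (s ≟ s) ×-dec (a ≟ a)
      ... | yes _ = refl
      ... | no neq = contradiction (refl , refl) neq
      forth-back {r} {t} e | no _ with (r ≟ s) ×-dec (t ≟ a)
      ... | yes (refl , refl) = contradiction refl (proj₁ (at-s e))
      ... | no _ = refl

      back-injective : ∀ {r t t′} → Edge slid r t → Edge slid r t′ → back r t ≡ back r t′ → t ≡ t′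
      back-injective {r} e e′ eq = cong proj₂
        (≡.trans (≡.sym (forth-back e)) (≡.trans (cong (λ t → forth (r , t)) eq) (forth-back e′)))

      old-edge : ∀ {r t} → r ≢ b → ¬ (r ≡ s × t ≡ b) → Edge slid r t → Edge host r t
      old-edge {r} r≢b ¬sb e with r ≟ s
      ... | no r≢s = elsewhere r≢b r≢s e
      ... | yes refl with at-s e
      ... | _ , inj₁ f = f
      ... | _ , inj₂ t≡b = contradiction (refl , t≡b) ¬sb

      back-edge : ∀ {r t} → r ≢ b → Edge slid r t → Edge host r (back r t)
      back-edge {r} {t} r≢b e with (r ≟ s) ×-dec (t ≟ b)
      ... | yes (refl , refl) = edge-sym host as
      ... | no ¬sb = old-edge r≢b ¬sb e

      old-∈ : ∀ {v r t} → r ≢ b → Edge host r t → r ∈ route v → t ∈ route′ v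
        → t ∈ route v ⊎ (r ≡ a × t ≡ b × s ∈ route v)
      old-∈ {v} {r} {t} r≢b e r∈ t∈ with t ≟ b | r ≟ a
      ... | no t≢b | _ = inj₁ (other⁻ (isRoute v) (isRoute′ v) t≢b t∈)
      ... | yes refl | r≟a with b⁻ (isRoute v) (isRoute′ v) t∈ | r≟a
      ... | inj₁ b∈ | _ = inj₁ b∈
      ... | inj₂ (_ , s∈) | yes r≡a = inj₂ (r≡a , refl , s∈)
      ... | inj₂ (a∈ , _) | no r≢a = inj₁ (Tree.between-neighbours isTree (isRoute v)
        (edge-sym host e) (edge-sym host ab) r≢a r∈ a∈)

      back-∈ : ∀ {v r t} → r ≢ b → Edge slid r t → r ∈ route v → t ∈ route′ v
        → back r t ∈ route v ⊎ (r ≡ a × t ≡ b × s ∈ route v)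
      back-∈ {v} {r} {t} r≢b e r∈ t∈ with (r ≟ s) ×-dec (t ≟ b)
      ... | yes (_ , refl) = inj₁ (b⇒a-old {v} t∈)
      ... | no ¬sb = old-∈ {v} r≢b (old-edge r≢b ¬sb e) r∈ t∈

    slid-clash : (∀ {t t′} → Edge slid b t → Edge slid b t′ → c b t ≡ c b t′ → t ≡ t′)
      → ∀ {L} → Clash R c L → Clash slidRep slidColour (map forth L)
    slid-clash inj {L} clash {r} {t} {t′} e e′ t≢t′ eq with r ≟ b
    ... | yes refl = contradiction
      (inj e e′ (≡.trans (≡.sym (cong (c b) (back-id b≢s))) (≡.trans eq (cong (c b) (back-id b≢s))))) t≢t′
    ... | no r≢b with clash (back-edge r≢b e) (back-edge r≢b e′) (t≢t′ ∘ back-injective e e′) eq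
    ... | inj₁ ∈L = inj₁ (subst (_∈ map forth L) (forth-back e) (∈-map⁺ forth ∈L))
    ... | inj₂ ∈L = inj₂ (subst (_∈ map forth L) (forth-back e′) (∈-map⁺ forth ∈L))

    slid-proper : (∀ {t t′} → Edge slid b t → Edge slid b t′ → c b t ≡ c b t′ → t ≡ t′)
      → Proper slidRep slidColour
    slid-proper inj {r} {t} {t′} e e′ t≢t′ eq v r∈ t∈ t′∈ with r ≟ b
    ... | yes refl = contradiction
      (inj e e′ (≡.trans (≡.sym (cong (c b) (back-id b≢s))) (≡.trans eq (cong (c b) (back-id b≢s))))) t≢t′
    ... | no r≢b = go e e′ t≢t′ eq (back-∈ {v} r≢b e r∈-old t∈) (back-∈ {v} r≢b e′ r∈-old t′∈) t′∈ t∈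
      where
      r∈-old : r ∈ route v
      r∈-old = other⁻ (isRoute v) (isRoute′ v) r≢b r∈
      -- The route gained `b` because it runs through `a` and `s`. As `b` and `s` have the same
      -- colour at `a`, the clash with `t′` is one between `s` and `t′` in the old tree.
      skips : ∀ {t t′} → Edge slid a t′ → t ≢ t′ → t ≡ b → c a (back a t) ≡ c a (back a t′)
        → s ∈ route v → a ∈ route v → t′ ∈ route′ v → ⊥
      skips e′ t≢t′ refl eq s∈ a∈ t′∈ with at-a e′
      ... | at′ , t′≢s = proper as at′ (t′≢s ∘ ≡.sym)
        (≡.trans (≡.sym c-eq) (≡.trans (≡.sym (cong (c a) (back-id a≢s))) (≡.trans eq (cong (c a) (back-id a≢s)))))
        v a∈ s∈ (other⁻ (isRoute v) (isRoute′ v) (t≢t′ ∘ ≡.sym) t′∈)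
      go : ∀ {t t′} → Edge slid r t → Edge slid r t′ → t ≢ t′ → c r (back r t) ≡ c r (back r t′)
        → back r t ∈ route v ⊎ (r ≡ a × t ≡ b × s ∈ route v)
        → back r t′ ∈ route v ⊎ (r ≡ a × t′ ≡ b × s ∈ route v)
        → t′ ∈ route′ v → t ∈ route′ v → ⊥
      go e e′ t≢t′ eq (inj₁ t∈) (inj₁ t′∈) _ _ =
        proper (back-edge r≢b e) (back-edge r≢b e′) (t≢t′ ∘ back-injective e e′) eq v r∈-old t∈ t′∈
      go e e′ t≢t′ eq (inj₂ (refl , t≡b , s∈)) _ t′∈ _ = skips e′ t≢t′ t≡b eq s∈ r∈-old t′∈
      go e e′ t≢t′ eq _ (inj₂ (refl , t′≡b , s∈)) _ t∈ =
        skips e (t≢t′ ∘ ≡.sym) t′≡b (≡.sym eq) s∈ r∈-old t∈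

module _ {n} {G : Graph n} {h′ : ℕ} where

  private
    h : ℕ
    h = suc (suc (suc h′))

  -- Split the vertex q: the branches t and t′, which have the same colour, are moved to a new neighbour of q.
  module Split {k} (R : Rep G k) (c : Fin k → Fin k → Fin h) (proper : Proper R c)
    (q t t′ : Fin k) (qt : Edge (Rep.host R) q t) (qt′ : Edge (Rep.host R) q t′) (t≢t′ : t ≢ t′)
    (c-eq : c q t ≡ c q t′) where

    open Rep R
    open Leaf isTree q

    private
      route⁺ : Fin n → List (Fin (suc k))
      route⁺ v = Tree.path leafed-tree (suc (x₀ v)) (suc (y₀ v))

      isRoute⁺ : ∀ v → PathFromTo leafed (suc (x₀ v)) (suc (y₀ v)) (route⁺ v)
      isRoute⁺ v = Tree.path-ok leafed-tree (suc (x₀ v)) (suc (y₀ v))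

      lowerShare : ∀ {u v} → Share (route⁺ u) (route⁺ v) → Share (route u) (route v)
      lowerShare {u} (zero , z∈ , _) = contradiction z∈ (leaf-∉ (isRoute u) (isRoute⁺ u))
      lowerShare {u} {v} (suc z , z∈u , z∈v) =
        z , suc⁻ (isRoute u) (isRoute⁺ u) z∈u , suc⁻ (isRoute v) (isRoute⁺ v) z∈v

    leafRep : Rep G (suc k)
    leafRep = record
      { host = leafed
      ; isTree = leafed-tree
      ; x₀ = suc ∘ x₀
      ; y₀ = suc ∘ y₀
      ; route = route⁺
      ; isRoute = isRoute⁺
      ; rep⁺ = λ {u} {v} u≢v e → let z , z∈u , z∈v = rep⁺ u≢v e in
          suc z , suc⁺ (isRoute u) (isRoute⁺ u) z∈u , suc⁺ (isRoute v) (isRoute⁺ v) z∈v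
      ; rep⁻ = λ {u} {v} u≢v s → rep⁻ u≢v (lowerShare {u} {v} s)
      }

    -- The leaf is to become adjacent to `q`, `t` and `t′`, which receive three different colours
    -- there. As seen from `q`, it has the common colour of `t` and `t′`, so both may slide onto it.
    leafColour : Fin (suc k) → Fin (suc k) → Fin h
    leafColour zero zero = zero
    leafColour zero (suc y) with y ≟ q | y ≟ t
    ... | yes _ | _ = zero
    ... | no _ | yes _ = suc zero
    ... | no _ | no _ = suc (suc zero)
    leafColour (suc _) zero = c q t′
    leafColour (suc x) (suc y) = c x y

    private
      q≢t : q ≢ t
      q≢t = edge-≢ host qt

      q≢t′ : q ≢ t′
      q≢t′ = edge-≢ host qt′

      colour-q : leafColour zero (suc q) ≡ zero
      colour-q with q ≟ q
      ... | yes _ = refl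
      ... | no neq = contradiction refl neq

      colour-t : leafColour zero (suc t) ≡ suc zero
      colour-t with t ≟ q | t ≟ t
      ... | yes eq | _ = contradiction (≡.sym eq) q≢t
      ... | no _ | yes _ = refl
      ... | no _ | no neq = contradiction refl neq

      colour-t′ : leafColour zero (suc t′) ≡ suc (suc zero)
      colour-t′ with t′ ≟ q | t′ ≟ t
      ... | yes eq | _ = contradiction (≡.sym eq) q≢t′
      ... | no _ | yes eq = contradiction (≡.sym eq) t≢t′
      ... | no _ | no _ = refl

      leaf-proper : Proper leafRep leafColour
      leaf-proper {zero} e e′ neq _ _ _ _ _ = neq (≡.trans (at-leaf e) (≡.sym (at-leaf e′)))
      leaf-proper {suc _} {zero} _ _ _ _ v _ z∈ _ = leaf-∉ (isRoute v) (isRoute⁺ v) z∈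
      leaf-proper {suc _} {suc _} {zero} _ _ _ _ v _ _ z∈ = leaf-∉ (isRoute v) (isRoute⁺ v) z∈
      leaf-proper {suc _} {suc _} {suc _} e e′ neq eq v r∈ t∈ t′∈ =
        proper (leafed⁻ e) (leafed⁻ e′) (neq ∘ cong suc) eq v (low r∈) (low t∈) (low t′∈)
        where
        low : ∀ {z} → suc z ∈ route⁺ v → z ∈ route v
        low = suc⁻ (isRoute v) (isRoute⁺ v)

      both : Fin k × Fin k → Fin (suc k) × Fin (suc k)
      both (x , y) = suc x , suc y

      -- The leaf clashes with `t′` at `q`, so `(q , t′)` is listed until its edge has been slid
      -- away. Any further neighbour of that colour clashes with `t′` and is listed already, because
      -- `(q , t′)` was not.
      leaf-clash : ∀ {L} → Clash R c ((q , t) ∷ L) → (q , t′) ∉ L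
        → Clash leafRep leafColour ((suc q , suc t) ∷ (suc q , suc t′) ∷ map both L)
      leaf-clash clash ∉L {zero} e e′ neq _ = contradiction (≡.trans (at-leaf e) (≡.sym (at-leaf e′))) neq
      leaf-clash {L} clash ∉L {suc r} {u} {u′} e e′ neq eq = go u u′ e e′ neq eq
        where
        Target = (suc q , suc t) ∷ (suc q , suc t′) ∷ map both L
        old : ∀ {r u} → (r , u) ∈ (q , t) ∷ L → (suc r , suc u) ∈ Target
        old (here refl) = here refl
        old (there ∈L) = there (there (∈-map⁺ both ∈L))
        new : ∀ {r} u → r ≡ q → Edge leafed (suc r) (suc u) → c q t′ ≡ c r u → (suc r , suc u) ∈ Target
        new u refl e eq with u ≟ t′
        ... | yes refl = there (here refl)
        ... | no u≢t′ with clash qt′ (leafed⁻ e) (u≢t′ ∘ ≡.sym) eq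
        ... | inj₁ (here eq′) = contradiction (≡.sym (cong proj₂ eq′)) t≢t′
        ... | inj₁ (there ∈L) = contradiction ∈L ∉L
        ... | inj₂ ∈L = old ∈L
        go : ∀ u u′ → Edge leafed (suc r) u → Edge leafed (suc r) u′ → u ≢ u′
          → leafColour (suc r) u ≡ leafColour (suc r) u′
          → (suc r , u) ∈ Target ⊎ (suc r , u′) ∈ Target
        go zero zero _ _ neq _ = contradiction refl neq
        go zero (suc u′) e e′ _ eq = inj₂ (new u′ (leafed⁻ e) e′ eq)
        go (suc u) zero e e′ _ eq = inj₁ (new u (leafed⁻ e′) e (≡.sym eq))
        go (suc u) (suc u′) e e′ neq eq with clash (leafed⁻ e) (leafed⁻ e′) (neq ∘ cong suc) eq
        ... | inj₁ ∈L = inj₁ (old ∈L)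
        ... | inj₂ ∈L = inj₂ (old ∈L)

      b⇒a₀ : ∀ {v} → zero ∈ route⁺ v → suc q ∈ route⁺ v
      b⇒a₀ {v} z∈ = contradiction z∈ (leaf-∉ (isRoute v) (isRoute⁺ v))

    private
      module S₁ = Slide leafed-tree (suc q) zero (suc t) (edge-sym leafed leaf-edge) (leafed⁺ qt) (λ ())
      module C₁ = SlideColoured leafRep leafColour leaf-proper (suc q) zero (suc t)
        (edge-sym leafed leaf-edge) (leafed⁺ qt) (λ ()) (≡.sym c-eq) (λ {v} → b⇒a₀ {v})

      near₁ : ∀ {u} → Edge S₁.slid zero u → u ≡ suc q ⊎ u ≡ suc t
      near₁ e with S₁.at-b e
      ... | inj₁ f = inj₁ (at-leaf f)
      ... | inj₂ eq = inj₂ eq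

      inj₁′ : ∀ {u u′} → Edge S₁.slid zero u → Edge S₁.slid zero u′
        → leafColour zero u ≡ leafColour zero u′ → u ≡ u′
      inj₁′ e e′ eq with near₁ e | near₁ e′
      ... | inj₁ refl | inj₁ refl = refl
      ... | inj₂ refl | inj₂ refl = refl
      ... | inj₁ refl | inj₂ refl =
        contradiction (≡.trans (≡.sym colour-q) (≡.trans eq colour-t)) λ ()
      ... | inj₂ refl | inj₁ refl =
        contradiction (≡.trans (≡.sym colour-t) (≡.trans eq colour-q)) λ ()

      proper₁ : Proper C₁.slidRep C₁.slidColour
      proper₁ = C₁.slid-proper inj₁′

      as₁ : Edge S₁.slid (suc q) (suc t′)
      as₁ = S₁.keep (leafed⁺ qt′) λ
        { (inj₁ (_ , eq)) → t≢t′ (≡.sym (suc-injective eq)) ; (inj₂ (eq , _)) → q≢t (suc-injective eq) }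

      c-eq₁ : C₁.slidColour (suc q) zero ≡ C₁.slidColour (suc q) (suc t′)
      c-eq₁ = ≡.trans (cong (leafColour (suc q)) (C₁.back-id (q≢t ∘ suc-injective)))
        (≡.sym (cong (leafColour (suc q)) (C₁.back-id (q≢t ∘ suc-injective))))

      b⇒a₁ : ∀ {v} → zero ∈ C₁.route′ v → suc q ∈ C₁.route′ v
      b⇒a₁ {v} = C₁.slid-b⇒a {v}

      module S₂ = Slide S₁.slid-tree (suc q) zero (suc t′) S₁.ab′ as₁ (λ ())
      module C₂ = SlideColoured C₁.slidRep C₁.slidColour proper₁ (suc q) zero (suc t′)
        S₁.ab′ as₁ (λ ()) c-eq₁ (λ {v} → b⇒a₁ {v})

      colour₂ : ∀ u → C₁.slidColour zero u ≡ leafColour zero u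
      colour₂ u = cong (leafColour zero) (C₁.back-id {zero} {u} λ ())

      near₂ : ∀ {u} → Edge S₂.slid zero u → u ≡ suc q ⊎ u ≡ suc t ⊎ u ≡ suc t′
      near₂ e with S₂.at-b e
      ... | inj₂ eq = inj₂ (inj₂ eq)
      ... | inj₁ f with near₁ f
      ... | inj₁ eq = inj₁ eq
      ... | inj₂ eq = inj₂ (inj₁ eq)

      inj₂′ : ∀ {u u′} → Edge S₂.slid zero u → Edge S₂.slid zero u′
        → C₁.slidColour zero u ≡ C₁.slidColour zero u′ → u ≡ u′
      inj₂′ {u} {u′} e e′ eq =
        go (near₂ e) (near₂ e′) (≡.trans (≡.sym (colour₂ u)) (≡.trans eq (colour₂ u′)))
        where
        go : ∀ {u u′} → u ≡ suc q ⊎ u ≡ suc t ⊎ u ≡ suc t′ → u′ ≡ suc q ⊎ u′ ≡ suc t ⊎ u′ ≡ suc t′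
          → leafColour zero u ≡ leafColour zero u′ → u ≡ u′
        clash : ∀ {u u′ i j} → leafColour zero u ≡ i → leafColour zero u′ ≡ j → i ≢ j
          → leafColour zero u ≡ leafColour zero u′ → u ≡ u′
        clash eq₁ eq₂ i≢j eq = contradiction (≡.trans (≡.sym eq₁) (≡.trans eq eq₂)) i≢j
        go (inj₁ refl) (inj₁ refl) _ = refl
        go (inj₁ refl) (inj₂ (inj₁ refl)) = clash colour-q colour-t λ ()
        go (inj₁ refl) (inj₂ (inj₂ refl)) = clash colour-q colour-t′ λ ()
        go (inj₂ (inj₁ refl)) (inj₁ refl) = clash colour-t colour-q λ ()
        go (inj₂ (inj₁ refl)) (inj₂ (inj₁ refl)) _ = refl
        go (inj₂ (inj₁ refl)) (inj₂ (inj₂ refl)) = clash colour-t colour-t′ λ ()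
        go (inj₂ (inj₂ refl)) (inj₁ refl) = clash colour-t′ colour-q λ ()
        go (inj₂ (inj₂ refl)) (inj₂ (inj₁ refl)) = clash colour-t′ colour-t λ ()
        go (inj₂ (inj₂ refl)) (inj₂ (inj₂ refl)) _ = refl

      not-qt : ¬ Edge S₂.slid (suc q) (suc t)
      not-qt e = S₁.not-as (proj₁ (S₂.at-a e))

    splitRep : Rep G (suc k)
    splitRep = C₂.slidRep

    splitColour : Fin (suc k) → Fin (suc k) → Fin h
    splitColour = C₂.slidColour

    split-proper : Proper splitRep splitColour
    split-proper = C₂.slid-proper inj₂′

    split-clash : ∀ {L} → Clash R c ((q , t) ∷ L) → (q , t′) ∉ L
      → Clash splitRep splitColour (map C₂.forth (map C₁.forth (map both L)))
    split-clash {L} clash ∉L =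
      -- The edges from `q` to `t` and to `t′` no longer exist, so both entries are dropped and the
      -- list is one shorter than before the split.
      clash-tail C₂.slidRep (clash-tail C₂.slidRep clash₂ not-qt) S₂.not-as
      where
      fixed : ∀ u → C₂.forth (C₁.forth (suc q , u)) ≡ (suc q , u)
      fixed u = ≡.trans (cong C₂.forth (C₁.forth-id (q≢t ∘ suc-injective))) (C₂.forth-id (q≢t′ ∘ suc-injective))
      rest = map C₂.forth (map C₁.forth (map both L))
      clash₂ : Clash C₂.slidRep C₂.slidColour ((suc q , suc t) ∷ (suc q , suc t′) ∷ rest)
      clash₂ = subst (Clash C₂.slidRep C₂.slidColour)
        (≡.cong₂ (λ e e′ → e ∷ e′ ∷ rest) (fixed (suc t)) (fixed (suc t′)))
        (C₂.slid-clash inj₂′ (C₁.slid-clash inj₁′ (leaf-clash clash ∉L)))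

    split-length : ∀ L → length (map C₂.forth (map C₁.forth (map both L))) ≡ length L
    split-length L = ≡.trans (length-map C₂.forth (map C₁.forth (map both L)))
      (≡.trans (length-map C₁.forth (map both L)) (length-map both L))

  -- At the start every pair is listed. If the first entry clashes with an unlisted edge, a split
  -- disposes of it; otherwise each of its clashes is covered by the rest of the list and the entry
  -- is discarded.
  coloured⇒InH21 : ∀ {k} (R : Rep G k) (c : Fin k → Fin k → Fin h) → Proper R c → InH21 h G
  coloured⇒InH21 {k} R c proper = go _ R c proper (cartesianProduct (allFin k) (allFin k)) ≤-refl
    λ {r} {t} _ _ _ _ → inj₁ (∈-cartesianProduct⁺ (∈-allFin r) (∈-allFin t))
    where
    go : ∀ fuel {k} (R : Rep G k) (c : Fin k → Fin k → Fin h) → Proper R c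
      → ∀ L → length L ≤ fuel → Clash R c L → InH21 h G
    go _ R c proper [] _ clash = toVPT R , no-clash⇒degree R clash
    go (suc fuel) {k} R c proper ((q , t) ∷ L) (s≤s L≤) clash
      with any? (λ t′ → edge? (Rep.host R) q t ×-dec edge? (Rep.host R) q t′ ×-dec ¬? (t ≟ t′)
        ×-dec (c q t ≟ c q t′) ×-dec ¬? (DecMembership._∈?_ (≡-dec _≟_ _≟_) (q , t′) L))
    ... | yes (t′ , qt , qt′ , t≢t′ , eq , ∉L) =
      go fuel splitRep splitColour split-proper _ (subst (_≤ fuel) (≡.sym (split-length L)) L≤)
        (split-clash clash ∉L)
      where open Split R c proper q t t′ qt qt′ t≢t′ eq
    ... | no none = go fuel R c proper L L≤ shorter
      where
      listed : ∀ {t′} → Edge (Rep.host R) q t → Edge (Rep.host R) q t′ → t ≢ t′ → c q t ≡ c q t′ → (q , t′) ∈ L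
      listed {t′} qt qt′ t≢t′ eq = decidable-stable (DecMembership._∈?_ (≡-dec _≟_ _≟_) (q , t′) L)
        λ ∉L → none (t′ , qt , qt′ , t≢t′ , eq , ∉L)
      shorter : Clash R c L
      shorter e e′ t≢t′ eq with clash e e′ t≢t′ eq
      ... | inj₁ (there ∈L) = inj₁ ∈L
      ... | inj₂ (there ∈L) = inj₂ ∈L
      ... | inj₁ (here refl) = inj₂ (listed e e′ t≢t′ eq)
      ... | inj₂ (here refl) = inj₁ (listed e′ e (t≢t′ ∘ ≡.sym) (≡.sym eq))

-- The branch graph of a clique

-- The trace of a vertex u is the set of its neighbours in C.
module Traces {n} (G : Graph n) (C : Fin n → Set) (C? : ∀ x → Dec (C x)) where

  Meet : Fin n → Fin n → Set
  Meet u v = ∃ λ x → C x × Edge G x u × Edge G x v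

  Beats : Fin n → Fin n → Set
  Beats u v = ∃ λ x → C x × Edge G x u × ¬ Edge G x v

  Below : Fin n → Fin n → Set
  Below u v = ∀ x → C x → Edge G x u → Edge G x v

  -- Adjacency in the branch graph of C: the traces intersect and are incomparable.
  Conflict : Fin n → Fin n → Set
  Conflict u v = Meet u v × Beats u v × Beats v u

  conflict-sym : ∀ {u v} → Conflict u v → Conflict v u
  conflict-sym ((x , Cx , xu , xv) , u>v , v>u) = (x , Cx , xv , xu) , v>u , u>v

  below⊎beats : ∀ u v → Below u v ⊎ Beats u v
  below⊎beats u v with any? (λ x → C? x ×-dec edge? G x u ×-dec ¬? (edge? G x v))
  ... | yes beats = inj₂ beats
  ... | no ¬beats = inj₁ λ x Cx xu → decidable-stable (edge? G x v) λ ¬xv → ¬beats (x , Cx , xu , ¬xv)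

  below? : ∀ u v → Dec (Below u v)
  below? u v with below⊎beats u v
  ... | inj₁ below = yes below
  ... | inj₂ (x , Cx , xu , ¬xv) = no λ below → ¬xv (below x Cx xu)

  below⇒¬beats : ∀ {u v} → Below u v → ¬ Beats u v
  below⇒¬beats below (x , Cx , xu , ¬xv) = ¬xv (below x Cx xu)

other : ∀ {h} → Fin (suc (suc h)) → Fin (suc (suc h))
other zero = suc zero
other (suc _) = zero

other-≢ : ∀ {h} (i : Fin (suc (suc h))) → i ≢ other i
other-≢ zero ()
other-≢ (suc _) ()

punchView : ∀ {n} (w u : Fin (suc n)) → u ≡ w ⊎ ∃ λ i → u ≡ punchIn w i
punchView w u with w ≟ u
... | yes refl = inj₁ refl
... | no w≢u = inj₂ (punchOut w≢u , ≡.sym (punchIn-punchOut w≢u))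

-- In a representation of G - w, the paths of C have a common host vertex q; two conflicting vertices lie in
-- different branches at q.
deletion-colouring : ∀ {n h} (G : Graph (suc n)) (C : Fin (suc n) → Set) (C? : ∀ x → Dec (C x))
  → (∀ {x y} → C x → C y → x ≢ y → Edge G x y) → ∀ {w} → ¬ C w → InH21 (suc h) (delete G w)
  → ∃ λ (c : Fin (suc n) → Fin (suc h)) → ∀ {u v} → u ≢ w → v ≢ w → ¬ C u → ¬ C v
    → Traces.Conflict G C C? u v → c u ≢ c v
deletion-colouring {n} {h} G C C? clique {w} w∉ (V , deg≤) = colour , proper
  where
  open Traces G C C?
  R = fromVPT V
  open Rep R
  open Tree isTree
  K = filter (λ i → C? (punchIn w i)) (allFin n)

  in-K : ∀ {i} → C (punchIn w i) → i ∈ K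
  in-K {i} Ci = ∈-filter⁺ (λ i → C? (punchIn w i)) (∈-allFin i) Ci

  meet : ∀ {i j} → i ∈ K → j ∈ K → Share (route i) (route j)
  meet {i} {j} i∈ j∈ with i ≟ j
  ... | yes refl = x₀ i , start-∈ (isRoute i) , start-∈ (isRoute i)
  ... | no i≢j = rep⁺ i≢j (clique (in-C i∈) (in-C j∈) (i≢j ∘ punchIn-injective w i j))
    where
    in-C : ∀ {i} → i ∈ K → C (punchIn w i)
    in-C i∈ = proj₂ (∈-filter⁻ (λ i → C? (punchIn w i)) {xs = allFin n} i∈)

  root : ∀ {k} → 1 ≤ k → Fin k
  root (s≤s _) = zero

  common : ∃ λ q → ∀ {i} → i ∈ K → q ∈ route i
  common = helly route (λ i → x₀ i , y₀ i , isRoute i) (root (proj₁ isTree)) K meet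

  q = proj₁ common

  through : ∀ {i} → C (punchIn w i) → q ∈ route i
  through Ci = proj₂ common (in-K Ci)

  branch : ∀ x → x ≢ q → ∃ λ j → Avoiding host q x (nth (adj host q) j)
  branch x x≢q with b , bq , v ← firstHit (connect x q) x≢q
    with j , refl ← rank (adj host q) b (edge-sym host bq) = j , mapʷ proj₂ v

  colourᴿ : Fin n → Fin (suc h)
  colourᴿ i with x₀ i ≟ q
  ... | yes _ = zero
  ... | no x≢q = inject≤ (proj₁ (branch (x₀ i) x≢q)) (deg≤ q)

  same-branch : ∀ {i j} → q ∉ route i → q ∉ route j → colourᴿ i ≡ colourᴿ j → Avoiding host q (x₀ i) (x₀ j)
  same-branch {i} {j} q∉i q∉j eq with x₀ i ≟ q | x₀ j ≟ q
  ... | yes x≡q | _ = contradiction (subst (_∈ route i) x≡q (start-∈ (isRoute i))) q∉i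
  ... | no _ | yes y≡q = contradiction (subst (_∈ route j) y≡q (start-∈ (isRoute j))) q∉j
  ... | no x≢q | no y≢q = proj₂ (branch (x₀ i) x≢q) ++ʷ
    subst (λ l → Avoiding host q (nth (adj host q) l) (x₀ j)) (≡.sym (inject≤-injective _ _ _ _ eq))
      (reverseʷ (proj₂ (branch (x₀ j) y≢q)))

  colour : Fin (suc n) → Fin (suc h)
  colour u with punchView w u
  ... | inj₁ _ = zero
  ... | inj₂ (i , _) = colourᴿ i

  at-C : ∀ {x} → C x → ∃ λ i → x ≡ punchIn w i
  at-C {x} Cx with punchView w x
  ... | inj₁ refl = contradiction Cx w∉
  ... | inj₂ view = view

  distinct : ∀ {x i} → C (punchIn w x) → ¬ C (punchIn w i) → x ≢ i
  distinct Cx ¬Ci refl = ¬Ci Cx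

  -- A route through `q` would make its vertex adjacent to all of `C` in `G - w`, leaving nothing
  -- for `v` to beat.
  missed : ∀ {i v} → ¬ C (punchIn w i) → Beats v (punchIn w i) → q ∉ route i
  missed ¬Ci (y , Cy , _ , ¬yi) q∈ with _ , refl ← at-C Cy =
    ¬yi (rep⁻ (distinct Cy ¬Ci) (q , through Cy , q∈))

  properᴿ : ∀ {i j} → ¬ C (punchIn w i) → ¬ C (punchIn w j) → Conflict (punchIn w i) (punchIn w j)
    → colourᴿ i ≢ colourᴿ j
  properᴿ {i} {j} ¬Ci ¬Cj ((x , Cx , xi , xj) , i>j@(y , Cy , yi , ¬yj) , j>i@(z , Cz , zj , ¬zi)) eq
    with at-C Cx | at-C Cy | at-C Cz
  ... | x′ , refl | y′ , refl | z′ , refl =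
    same-branch-nested (isRoute i) (isRoute j) q∉i q∉j (start-∈ (isRoute i)) (start-∈ (isRoute j))
      (same-branch q∉i q∉j eq)
      (isRoute x′) (through Cx) (rep⁺ (distinct Cx ¬Ci) xi) (rep⁺ (distinct Cx ¬Cj) xj)
      (isRoute y′) (through Cy) (rep⁺ (distinct Cy ¬Ci) yi) (¬yj ∘ rep⁻ (distinct Cy ¬Cj))
      (isRoute z′) (through Cz) (rep⁺ (distinct Cz ¬Cj) zj) (¬zi ∘ rep⁻ (distinct Cz ¬Ci))
    where
    q∉i = missed ¬Ci j>i
    q∉j = missed ¬Cj i>j

  proper : ∀ {u v} → u ≢ w → v ≢ w → ¬ C u → ¬ C v → Conflict u v → colour u ≢ colour v
  proper {u} {v} u≢w v≢w ¬Cu ¬Cv conflict with punchView w u | punchView w v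
  ... | inj₁ eq | _ = contradiction eq u≢w
  ... | inj₂ _ | inj₁ eq = contradiction eq v≢w
  ... | inj₂ (i , refl) | inj₂ (j , refl) = properᴿ ¬Cu ¬Cv conflict

-- A colouring that is proper away from w becomes proper everywhere when the trace of w lies below that of v:
-- the vertices below v in the branch of v may all receive the colour of v, and those in other branches
-- only conflict with the former.
module Recolouring {n} (G : Graph n) (C : Fin n → Set) (C? : ∀ x → Dec (C x))
  (_~_ : Fin n → Fin n → Set) (_~?_ : ∀ u v → Dec (u ~ v))
  (~-sym : ∀ {u v} → u ~ v → v ~ u) (~-trans : ∀ {u v w} → u ~ v → v ~ w → u ~ w)
  (two-branches : ∀ {x u v w} → C x → ¬ C u → ¬ C v → ¬ C w → Edge G x u → Edge G x v → Edge G x w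
    → u ~ v ⊎ v ~ w ⊎ u ~ w)
  (no-conflict : ∀ {u v} → ¬ C u → ¬ C v → u ~ v → ¬ Traces.Conflict G C C? u v)
  where

  open Traces G C C?

  nested : ∀ {u v} → ¬ C u → ¬ C v → u ~ v → Meet u v → Below u v ⊎ Below v u
  nested {u} {v} ¬Cu ¬Cv u~v meet with below⊎beats u v | below⊎beats v u
  ... | inj₁ b | _ = inj₁ b
  ... | inj₂ _ | inj₁ b = inj₂ b
  ... | inj₂ a | inj₂ b = contradiction (meet , a , b) (no-conflict ¬Cu ¬Cv u~v)

  module _ {h} {v w} (w≢v : w ≢ v) (¬Cv : ¬ C v) (¬Cw : ¬ C w) (w≤v : Below w v)
    (c : Fin n → Fin (suc (suc h)))
    (proper : ∀ {u u′} → u ≢ w → u′ ≢ w → ¬ C u → ¬ C u′ → Conflict u u′ → c u ≢ c u′) where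

    Lower : Fin n → Set
    Lower u = u ≢ v × ¬ C u × Below u v

    lower? : ∀ u → Dec (Lower u)
    lower? u = ¬? (u ≟ v) ×-dec ¬? (C? u) ×-dec below? u v

    recolour : Fin n → Fin (suc (suc h))
    recolour u with lower? u | u ~? v
    ... | no _ | _ = c u
    ... | yes _ | yes _ = c v
    ... | yes _ | no _ = other (c v)

    private
      -- A member `x` of `C` adjacent to `a` and `b` is adjacent to `v` too, as `a` lies below `v`.
      -- It meets only two branches, so `b` shares that of `v` and is nested with it; `v` below `b`
      -- would put `a` below `b`.
      across : ∀ {a b} → Lower a → ¬ a ~ v → ¬ C b → Conflict a b → Lower b × b ~ v
      across {a} {b} (_ , ¬Ca , a≤v) a≁v ¬Cb conflict@((x , Cx , xa , xb) , a>b , b>a)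
        with two-branches Cx ¬Ca ¬Cb ¬Cv xa xb (a≤v _ Cx xa)
      ... | inj₁ a~b = contradiction conflict (no-conflict ¬Ca ¬Cb a~b)
      ... | inj₂ (inj₂ a~v) = contradiction a~v a≁v
      ... | inj₂ (inj₁ b~v) with nested ¬Cb ¬Cv b~v (x , Cx , xb , a≤v _ Cx xa)
      ... | inj₁ b≤v = ((λ { refl → below⇒¬beats a≤v a>b }) , ¬Cb , b≤v) , b~v
      ... | inj₂ v≤b = contradiction a>b (below⇒¬beats λ _ Cx xa → v≤b _ Cx (a≤v _ Cx xa))

      -- This is why `b` may take the colour of `v`: whatever conflicts with `b` and is not itself
      -- lower already conflicted with `v`.
      beside : ∀ {b b′} → Lower b → ¬ C b′ → ¬ Lower b′ → Conflict b b′ → Conflict v b′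
      beside {b} {b′} (_ , _ , b≤v) ¬Cb′ ¬lower ((x , Cx , xb , xb′) , b>b′ , _)
        with below⊎beats v b′ | below⊎beats b′ v
      ... | inj₁ v≤b′ | _ = contradiction b>b′ (below⇒¬beats λ _ Cx xb → v≤b′ _ Cx (b≤v _ Cx xb))
      ... | inj₂ _ | inj₁ b′≤v =
        contradiction ((λ { refl → below⇒¬beats b≤v b>b′ }) , ¬Cb′ , b′≤v) ¬lower
      ... | inj₂ v>b′ | inj₂ b′>v = (x , Cx , b≤v _ Cx xb , xb′) , v>b′ , b′>v

      -- As `w` is itself lower, the meaningless value `c w` is never consulted.
      ≢w : ∀ {u} → ¬ Lower u → u ≢ w
      ≢w ¬lower refl = ¬lower (w≢v , ¬Cw , w≤v)

    recolour-proper : ∀ {u u′} → ¬ C u → ¬ C u′ → Conflict u u′ → recolour u ≢ recolour u′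
    recolour-proper {u} {u′} ¬Cu ¬Cu′ conflict
      with lower? u | u ~? v | lower? u′ | u′ ~? v
    ... | no ¬l | _ | no ¬l′ | _ = proper (≢w ¬l) (≢w ¬l′) ¬Cu ¬Cu′ conflict
    ... | yes l | yes _ | no ¬l′ | _ = proper (w≢v ∘ ≡.sym) (≢w ¬l′) ¬Cv ¬Cu′ (beside l ¬Cu′ ¬l′ conflict)
    ... | no ¬l | _ | yes l′ | yes _ =
      proper (w≢v ∘ ≡.sym) (≢w ¬l) ¬Cv ¬Cu (beside l′ ¬Cu ¬l (conflict-sym conflict)) ∘ ≡.sym
    ... | yes l | no u≁v | no ¬l′ | _ = contradiction (proj₁ (across l u≁v ¬Cu′ conflict)) ¬l′
    ... | no ¬l | _ | yes l′ | no u′≁v = contradiction (proj₁ (across l′ u′≁v ¬Cu (conflict-sym conflict))) ¬l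
    ... | yes _ | yes u~v | yes _ | yes u′~v =
      contradiction conflict (no-conflict ¬Cu ¬Cu′ (~-trans u~v (~-sym u′~v)))
    ... | yes _ | yes _ | yes _ | no _ = other-≢ (c v)
    ... | yes _ | no _ | yes _ | yes _ = other-≢ (c v) ∘ ≡.sym
    ... | yes l | no u≁v | yes _ | no u′≁v = contradiction (proj₂ (across l u≁v ¬Cu′ conflict)) u′≁v

-- A family E of sets in which every point lies in at most two members, seen as a multigraph whose vertices
-- are the members and whose edges are the points. A member contained in another one is a leaf, so it can be
-- coloured after its only neighbour.
module LeafColouring {k n} (E : Fin k → Fin n → Set) (E? : ∀ t x → Dec (E t x))
  (at-most-two : ∀ {x t₁ t₂ t₃} → t₁ ≢ t₂ → t₂ ≢ t₃ → t₁ ≢ t₃ → E t₁ x → E t₂ x → ¬ E t₃ x)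
  {h} (c : Fin k → Fin (suc (suc h)))
  (proper : ∀ {t t′ x} → E t x → E t′ x → (∃ λ y → E t y × ¬ E t′ y) → (∃ λ y → E t′ y × ¬ E t y) → c t ≢ c t′)
  where

  Within : Fin k → Fin k → Set
  Within t t′ = t′ ≢ t × (∀ x → E t x → E t′ x)

  Leaf? : Fin k → Set
  Leaf? t = Dec (∃ (Within t))

  leaf? : ∀ t → Leaf? t
  leaf? t = any? λ t′ → ¬? (t′ ≟ t) ×-dec all? (λ x → E? t x →-dec E? t′ x)

  -- For two leaves that are each other's only neighbour, that is, equal nonempty members: neither
  -- can wait for the other, so the order on `Fin k` decides.
  tie-break : Fin k → Fin k → Fin (suc (suc h))
  tie-break t t′ with <-cmp t t′
  ... | tri< _ _ _ = zero
  ... | tri≈ _ _ _ = zero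
  ... | tri> _ _ _ = suc zero

  tie-break-≢ : ∀ {t t′} → t ≢ t′ → tie-break t t′ ≢ tie-break t′ t
  tie-break-≢ {t} {t′} t≢t′ with <-cmp t t′ | <-cmp t′ t
  ... | tri≈ _ eq _ | _ = contradiction eq t≢t′
  ... | _ | tri≈ _ eq _ = contradiction (≡.sym eq) t≢t′
  ... | tri< _ _ _ | tri> _ _ _ = λ ()
  ... | tri> _ _ _ | tri< _ _ _ = λ ()
  ... | tri< _ _ ¬> | tri< gt _ _ = contradiction gt ¬>
  ... | tri> ¬< _ _ | tri> _ _ lt = contradiction lt ¬<

  leafColour : ∀ {t} → Leaf? t → Fin (suc (suc h))
  leafColour {t} (no _) = c t
  leafColour {t} (yes (t′ , _)) with leaf? t′
  ... | no _ = other (c t′)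
  ... | yes _ = tie-break t t′

  recoloured : Fin k → Fin (suc (suc h))
  recoloured t = leafColour (leaf? t)

  outlier : ∀ {t t′} → ¬ ∃ (Within t) → t′ ≢ t → ∃ λ y → E t y × ¬ E t′ y
  outlier {t} {t′} ¬leaf t′≢t with any? (λ y → E? t y ×-dec ¬? (E? t′ y))
  ... | yes found = found
  ... | no ¬found = contradiction
    (t′ , t′≢t , λ y Ety → decidable-stable (E? t′ y) λ ¬Et′y → ¬found (y , Ety , ¬Et′y)) ¬leaf

  only-neighbour : ∀ {t t′ t″ x} → E t x → E t′ x → t ≢ t′ → Within t t″ → t″ ≡ t′
  only-neighbour {t} {t′} {t″} {x} Etx Et′x t≢t′ (t″≢t , t⊆t″) with t″ ≟ t′
  ... | yes eq = eq
  ... | no t″≢t′ = contradiction (t⊆t″ x Etx) (at-most-two t≢t′ (t″≢t′ ∘ ≡.sym) (t″≢t ∘ ≡.sym) Etx Et′x)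

  leaf-≢ : ∀ {t t′ x} → E t x → E t′ x → t ≢ t′ → (d : Leaf? t) → ¬ ∃ (Within t′) → ∃ (Within t)
    → leafColour d ≢ c t′
  leaf-≢ _ _ _ (no ¬leaf) _ leaf = contradiction leaf ¬leaf
  leaf-≢ Etx Et′x t≢t′ (yes (t″ , within)) ¬leaf′ _ with only-neighbour Etx Et′x t≢t′ within
  ... | refl with leaf? t″
  ... | yes leaf′ = contradiction leaf′ ¬leaf′
  ... | no _ = other-≢ (c t″) ∘ ≡.sym

  leaf-pair : ∀ {t t′ x} → E t x → E t′ x → t ≢ t′ → (d : Leaf? t) → ∃ (Within t) → ∃ (Within t′)
    → leafColour d ≡ tie-break t t′
  leaf-pair _ _ _ (no ¬leaf) leaf _ = contradiction leaf ¬leaf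
  leaf-pair Etx Et′x t≢t′ (yes (t″ , within)) _ leaf′ with only-neighbour Etx Et′x t≢t′ within
  ... | refl with leaf? t″
  ... | yes _ = refl
  ... | no ¬leaf′ = contradiction leaf′ ¬leaf′

  free : ∀ {t} → (d : Leaf? t) → ¬ ∃ (Within t) → leafColour d ≡ c t
  free (no _) _ = refl
  free (yes leaf) ¬leaf = contradiction leaf ¬leaf

  recoloured-proper : ∀ {t t′ x} → E t x → E t′ x → t ≢ t′ → recoloured t ≢ recoloured t′
  recoloured-proper {t} {t′} {x} Etx Et′x t≢t′ = go (leaf? t) (leaf? t′)
    where
    go : Leaf? t → Leaf? t′ → recoloured t ≢ recoloured t′
    go (no ¬l) (no ¬l′) eq = proper Etx Et′x (outlier ¬l (t≢t′ ∘ ≡.sym)) (outlier ¬l′ t≢t′)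
      (≡.trans (≡.sym (free (leaf? t) ¬l)) (≡.trans eq (free (leaf? t′) ¬l′)))
    go (yes l) (no ¬l′) eq = leaf-≢ Etx Et′x t≢t′ (leaf? t) ¬l′ l (≡.trans eq (free (leaf? t′) ¬l′))
    go (no ¬l) (yes l′) eq = leaf-≢ Et′x Etx (t≢t′ ∘ ≡.sym) (leaf? t′) ¬l l′
      (≡.trans (≡.sym eq) (free (leaf? t) ¬l))
    go (yes l) (yes l′) eq = tie-break-≢ t≢t′ (≡.trans (≡.sym (leaf-pair Etx Et′x t≢t′ (leaf? t) l l′))
      (≡.trans eq (leaf-pair Et′x Etx (t≢t′ ∘ ≡.sym) (leaf? t′) l′ l)))

-- From traces at a host vertex to a colouring of its branches

module AtVertex {n} {G : Graph (suc n)} {k} (R : Rep G k) (q : Fin k) where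

  open Rep R
  open Tree isTree

  Through : Fin (suc n) → Set
  Through v = q ∈ route v

  through? : ∀ v → Dec (Through v)
  through? v = q ∈? route v

  open Traces G Through through?

  clique : ∀ {x y} → Through x → Through y → x ≢ y → Edge G x y
  clique q∈x q∈y x≢y = rep⁻ x≢y (q , q∈x , q∈y)

  distinct : ∀ {x u} → Through x → ¬ Through u → x ≢ u
  distinct q∈x q∉u refl = q∉u q∈x

  Dominated : Set
  Dominated = ∃ λ w → ∃ λ v → w ≢ v × ¬ Through v × ¬ Through w × Below w v

  dominated? : Dec Dominated
  dominated? = any? λ w → any? λ v → ¬? (w ≟ v) ×-dec ¬? (through? v) ×-dec ¬? (through? w) ×-dec below? w v

  -- Of two meeting routes, one contains the gate of the other. Every route through `q` that meets
  -- the latter passes this gate, and so meets the former.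
  adjacent⇒nested : ∀ {u v} → ¬ Through u → ¬ Through v → Edge G u v → Below u v ⊎ Below v u
  adjacent⇒nested {u} {v} q∉u q∉v uv with gate (isRoute u) q | gate (isRoute v) q
  ... | g , g-gate | g′ , g′-gate with gates-comparable (isRoute u) (isRoute v) g-gate g′-gate (rep⁺ (edge-≢ G uv) uv)
  ... | inj₁ g∈v = inj₁ λ x q∈x xu → rep⁻ (distinct q∈x q∉v)
    (g , through-gate (isRoute x) q∈x g-gate (rep⁺ (distinct q∈x q∉u) xu) , g∈v)
  ... | inj₂ g′∈u = inj₂ λ x q∈x xv → rep⁻ (distinct q∈x q∉u)
    (g′ , through-gate (isRoute x) q∈x g′-gate (rep⁺ (distinct q∈x q∉v) xv) , g′∈u)

  undominated⇒split : ¬ Dominated → SplitWithoutDominatedStable G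
  undominated⇒split ¬dom = S , (stable , complete) , undominated
    where
    S : Fin (suc n) → Bool
    S v = not (does (through? v))

    in-S : ∀ v → S v ≡ true → ¬ Through v
    in-S v Sv with through? v
    ... | no q∉ = q∉
    ... | yes _ = contradiction Sv λ ()

    in-K : ∀ v → S v ≡ false → Through v
    in-K v Sv with through? v
    ... | yes q∈ = q∈
    ... | no _ = contradiction Sv λ ()

    stable : ∀ u v → S u ≡ true → S v ≡ true → ¬ Edge G u v
    stable u v Su Sv uv with adjacent⇒nested (in-S u Su) (in-S v Sv) uv
    ... | inj₁ u≤v = ¬dom (u , v , edge-≢ G uv , in-S v Sv , in-S u Su , u≤v)
    ... | inj₂ v≤u = ¬dom (v , u , edge-≢ G uv ∘ ≡.sym , in-S u Su , in-S v Sv , v≤u)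

    complete : ∀ u v → S u ≡ false → S v ≡ false → u ≢ v → Edge G u v
    complete u v Su Sv = clique (in-K u Su) (in-K v Sv)

    undominated : ∀ s → ¬ DominatedStable G S s
    undominated s (Ss , s′ , Ss′ , s′≢s , N⊆) = ¬dom (s , s′ , s′≢s ∘ ≡.sym , in-S s′ Ss′ , in-S s Ss ,
      λ x _ xs → edge-sym G (N⊆ x (edge-sym G xs)))

  _~_ : Fin (suc n) → Fin (suc n) → Set
  u ~ v = Avoiding host q (x₀ u) (x₀ v)

  _~?_ : ∀ u v → Dec (u ~ v)
  u ~? v with q ∈? path (x₀ u) (x₀ v)
  ... | yes q∈ = no (separates (path-ok (x₀ u) (x₀ v)) q∈)
  ... | no q∉ = yes (avoid (path-ok (x₀ u) (x₀ v)) q∉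
    (start-∈ (path-ok (x₀ u) (x₀ v))) (end-∈ (path-ok (x₀ u) (x₀ v))))

  from-start : ∀ {u z} → ¬ Through u → z ∈ route u → Avoiding host q (x₀ u) z
  from-start {u} q∉ = avoid (isRoute u) q∉ (start-∈ (isRoute u))

  two-branches : ∀ {x u v w} → Through x → ¬ Through u → ¬ Through v → ¬ Through w
    → Edge G x u → Edge G x v → Edge G x w → u ~ v ⊎ v ~ w ⊎ u ~ w
  two-branches {x} q∈x q∉u q∉v q∉w xu xv xw
    with rep⁺ (distinct q∈x q∉u) xu | rep⁺ (distinct q∈x q∉v) xv | rep⁺ (distinct q∈x q∉w) xw
  ... | a , a∈ , a∈u | b , b∈ , b∈v | c , c∈ , c∈w
    with two-sides (isRoute x) q a∈ b∈ c∈ (λ { refl → q∉u a∈u }) (λ { refl → q∉v b∈v }) (λ { refl → q∉w c∈w })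
  ... | inj₁ ab = inj₁ (from-start q∉u a∈u ++ʷ (ab ++ʷ reverseʷ (from-start q∉v b∈v)))
  ... | inj₂ (inj₁ bc) = inj₂ (inj₁ (from-start q∉v b∈v ++ʷ (bc ++ʷ reverseʷ (from-start q∉w c∈w))))
  ... | inj₂ (inj₂ ac) = inj₂ (inj₂ (from-start q∉u a∈u ++ʷ (ac ++ʷ reverseʷ (from-start q∉w c∈w))))

  no-conflict : ∀ {u v} → ¬ Through u → ¬ Through v → u ~ v → ¬ Conflict u v
  no-conflict {u} {v} q∉u q∉v u~v ((x , q∈x , xu , xv) , (y , q∈y , yu , ¬yv) , (z , q∈z , zv , ¬zu)) =
    same-branch-nested (isRoute u) (isRoute v) q∉u q∉v (start-∈ (isRoute u)) (start-∈ (isRoute v)) u~v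
      (isRoute x) q∈x (rep⁺ (distinct q∈x q∉u) xu) (rep⁺ (distinct q∈x q∉v) xv)
      (isRoute y) q∈y (rep⁺ (distinct q∈y q∉u) yu) (¬yv ∘ rep⁻ (distinct q∈y q∉v))
      (isRoute z) q∈z (rep⁺ (distinct q∈z q∉v) zv) (¬zu ∘ rep⁻ (distinct q∈z q∉u))

  conflict-colouring : ∀ {h} → (∀ w → InH21 (suc (suc h)) (delete G w)) → Dominated
    → ∃ λ (c : Fin (suc n) → Fin (suc (suc h))) → ∀ {u v} → ¬ Through u → ¬ Through v → Conflict u v → c u ≢ c v
  conflict-colouring del (w , v , w≢v , q∉v , q∉w , w≤v)
    with c , proper ← deletion-colouring G Through through? clique q∉w (del w) =
    recolour w≢v q∉v q∉w w≤v c proper , recolour-proper w≢v q∉v q∉w w≤v c proper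
    where
    open Recolouring G Through through? _~_ _~?_ reverseʷ _++ʷ_ two-branches no-conflict

  module _ {h} (reduced : Reduced R) (c : Fin (suc n) → Fin (suc (suc h)))
    (proper : ∀ {u v} → ¬ Through u → ¬ Through v → Conflict u v → c u ≢ c v) where

    private
      E : Fin k → Fin (suc n) → Set
      E t x = Edge host q t × q ∈ route x × t ∈ route x

      E? : ∀ t x → Dec (E t x)
      E? t x = edge? host q t ×-dec (q ∈? route x) ×-dec (t ∈? route x)

      at-most-two : ∀ {x t₁ t₂ t₃} → t₁ ≢ t₂ → t₂ ≢ t₃ → t₁ ≢ t₃ → E t₁ x → E t₂ x → ¬ E t₃ x
      at-most-two {x} ne₁₂ ne₂₃ ne₁₃ (e₁ , q∈ , t₁∈) (e₂ , _ , t₂∈) (e₃ , _ , t₃∈)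
        with two-sides (isRoute x) q t₁∈ t₂∈ t₃∈ (edge-≢ host e₁ ∘ ≡.sym) (edge-≢ host e₂ ∘ ≡.sym) (edge-≢ host e₃ ∘ ≡.sym)
      ... | inj₁ a = acyclic e₁ e₂ ne₁₂ a
      ... | inj₂ (inj₁ a) = acyclic e₂ e₃ ne₂₃ a
      ... | inj₂ (inj₂ a) = acyclic e₁ e₃ ne₁₃ a

      Starts : Fin k → Fin (suc n) → Set
      Starts t v = t ∈ route v × q ∉ route v

      starts? : ∀ t → Dec (∃ (Starts t))
      starts? t = any? λ v → (t ∈? route v) ×-dec ¬? (q ∈? route v)

      -- A branch borrows the colour of any vertex whose route contains `t` and misses `q`. For a
      -- neighbour `t` of `q`, reducedness provides one unless no route uses `t`; the default is
      -- harmless.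
      branchColour : Fin k → Fin (suc (suc h))
      branchColour t with starts? t
      ... | yes (v , _) = c v
      ... | no _ = zero

      has-start : ∀ {t x} → E t x → ∃ (Starts t)
      has-start {x = x} (e , _ , t∈) with reduced (edge-sym host e)
      ... | inj₁ start = start
      ... | inj₂ unused = contradiction t∈ (unused x)

      trace⁺ : ∀ {t v x} → Starts t v → E t x → Edge G x v
      trace⁺ (t∈v , q∉v) (_ , q∈x , t∈x) = rep⁻ (distinct q∈x q∉v) (_ , t∈x , t∈v)

      -- The route of `v` stays within the branch of `t`, which a route coming from `q` can enter
      -- only through `t`. Together with `trace⁺` this identifies `E t` with the trace of `v`.
      trace⁻ : ∀ {t v x} → Edge host q t → Starts t v → q ∈ route x → Edge G x v → E t x
      trace⁻ {t} {v} {x} e (t∈v , q∉v) q∈x xv with rep⁺ (distinct q∈x q∉v) xv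
      ... | z , z∈x , z∈v with side (isRoute x) q z∈x (λ { refl → q∉v z∈v })
      ... | inj₁ a = e , q∈x , neighbour-∈ (isRoute x) q∈x e (a ++ʷ avoid (isRoute v) q∉v z∈v t∈v)
      ... | inj₂ a = e , q∈x , reverse-∈ back (isRoute x)
        (neighbour-∈ back (reverse-∈ (isRoute x) back q∈x) e (reverseʷ a ++ʷ avoid (isRoute v) q∉v z∈v t∈v))
        where back = path-ok (y₀ x) (x₀ x)

      branch-proper : ∀ {t t′ x} → E t x → E t′ x → (∃ λ y → E t y × ¬ E t′ y) → (∃ λ y → E t′ y × ¬ E t y)
        → branchColour t ≢ branchColour t′
      branch-proper {t} {t′} {x} Etx@(e , q∈x , _) Et′x@(e′ , _) (y , Ety , ¬Et′y) (z , Et′z , ¬Etz)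
        with starts? t | starts? t′
      ... | no ¬s | _ = contradiction (has-start Etx) ¬s
      ... | yes _ | no ¬s = contradiction (has-start Et′x) ¬s
      ... | yes (v , s) | yes (v′ , s′) = proper (proj₂ s) (proj₂ s′)
        ( (x , q∈x , trace⁺ s Etx , trace⁺ s′ Et′x)
        , (y , proj₁ (proj₂ Ety) , trace⁺ s Ety , ¬Et′y ∘ trace⁻ e′ s′ (proj₁ (proj₂ Ety)))
        , (z , proj₁ (proj₂ Et′z) , trace⁺ s′ Et′z , ¬Etz ∘ trace⁻ e s (proj₁ (proj₂ Et′z))))

      open LeafColouring E E? at-most-two branchColour branch-proper

    branch-colouring : ∃ λ (c : Fin k → Fin (suc (suc h))) → ∀ {t t′} → Edge host q t → Edge host q t′ → t ≢ t′
      → c t ≡ c t′ → ∀ v → q ∈ route v → t ∈ route v → t′ ∉ route v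
    branch-colouring = recoloured , λ qt qt′ t≢t′ eq v q∈ t∈ t′∈ →
      recoloured-proper (qt , q∈ , t∈) (qt′ , q∈ , t′∈) t≢t′ eq

theorem15 : (h n : ℕ) (G : Graph (suc n)) → Connected G → IsVPT G → 3 ≤ h
    → MinimalNonH21 h G → SplitWithoutDominatedStable G
theorem15 (suc (suc (suc h))) n G _ V (s≤s (s≤s (s≤s z≤n))) (¬InH , del)
  with R , reduced ← Reduction.reduce (fromVPT V)
  with any? (λ q → ¬? (AtVertex.dominated? R q))
... | yes (q , ¬dom) = AtVertex.undominated⇒split R q ¬dom
... | no all-dominated = contradiction
  (coloured⇒InH21 R (λ q → proj₁ (colouring q)) λ {q} → proj₂ (colouring q)) ¬InH
  where
  open Rep R
  colouring : ∀ q → ∃ λ (c : Fin _ → Fin (suc (suc (suc h)))) → ∀ {t t′} → Edge host q t → Edge host q t′ → t ≢ t′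
      → c t ≡ c t′ → ∀ v → q ∈ route v → t ∈ route v → t′ ∉ route v
  colouring q with c , proper ← AtVertex.conflict-colouring R q del
      (decidable-stable (AtVertex.dominated? R q) λ ¬dom → all-dominated (q , ¬dom)) =
    AtVertex.branch-colouring R q reduced c proper
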